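{- For every integer $k \geq 1$, the class $\mathcal{T}_k$ of all graphs of tree-width at most $k$ is homomorphism-distinguishing closed. That is, for every graph $F \notin \mathcal{T}_k$ (i.e. every graph $F$ of tree-width greater than $k$) there exist graphs $G$ and $H$ such that $\hom(F',G) = \hom(F',H)$ for all $F' \in \mathcal{T}_k$, but $\hom(F,G) \neq \hom(F,H)$.
   Context: All graphs are finite, simple and undirected. For graphs $F$ and $G$, a homomorphism from $F$ to $G$ is a map $\varphi\colon V(F)\to V(G)$ with $\varphi(v)\varphi(w)\in E(G)$ for all $vw\in E(F)$; $\hom(F,G)$ denotes the number of homomorphisms from $F$ to $G$. For a class of graphs $\mathcal{F}$, two graphs $G,H$ are $\mathcal{F}$-equivalent if $\hom(F,G)=\hom(F,H)$ for all $F\in\mathcal{F}$. A class $\mathcal{F}$ is called homomorphism-distinguishing closed if for every graph $F\notin\mathcal{F}$ there are graphs $G,H$ that are $\mathcal{F}$-equivalent but satisfy $\hom(F,G)\neq\hom(F,H)$. -}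

module Defs where

open import Data.Nat using (ℕ; zero; suc; _+_; _≤_)
open import Data.Bool using (Bool; true; false; not; _∨_; _∧_)
open import Data.Fin using (Fin; zero; suc; inject₁; fromℕ)
open import Data.Fin.Subset using (Subset; _∈_; ∣_∣)
open import Data.List using (List; []; _∷_; map; concatMap; filterᵇ; length; allFin)
open import Data.Bool.ListAction using (and)
open import Data.Product using (Σ; ∃; _×_; _,_)
open import Data.Unit using (⊤)
open import Relation.Nullary using (¬_)
open import Relation.Binary.PropositionalEquality using (_≡_)
open import Function.Definitions using (Injective)
import Data.Vec.Functional as VF

record Graph : Set where
  field
    size   : ℕ
    adj    : Fin size → Fin size → Bool
    sym    : ∀ i j → adj i j ≡ adj j i
    irrefl : ∀ i → adj i i ≡ false

open Graph public

V : Graph → Set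
V G = Fin (size G)

Adj : (G : Graph) → V G → V G → Set
Adj G x y = adj G x y ≡ true

allMaps : ∀ n m → List (Fin n → Fin m)
allMaps zero    m = (λ ()) ∷ []
allMaps (suc n) m = concatMap (λ f → map (λ x → x VF.∷ f) (allFin m)) (allMaps n m)

isHomᵇ : (F G : Graph) → (V F → V G) → Bool
isHomᵇ F G φ =
  and (map (λ i → and (map (λ j → not (adj F i j) ∨ adj G (φ i) (φ j))
                           (allFin (size F))))
           (allFin (size F)))

hom : Graph → Graph → ℕ
hom F G = length (filterᵇ (isHomᵇ F G) (allMaps (size F) (size G)))

data PWalk (G : Graph) (P : V G → Set) : V G → V G → Set where
  stop : ∀ {x} → P x → PWalk G P x x
  step : ∀ {x y z} → P x → Adj G x y → PWalk G P y z → PWalk G P x z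

Connected : Graph → Set
Connected G = ∀ (x y : V G) → PWalk G (λ _ → ⊤) x y

HasCycle : Graph → Set
HasCycle G =
  Σ ℕ λ l → Σ (Fin (suc (suc (suc l))) → V G) λ c →
    Injective _≡_ _≡_ c
    × (∀ (i : Fin (suc (suc l))) → Adj G (c (inject₁ i)) (c (suc i)))
    × Adj G (c (fromℕ (suc (suc l)))) (c zero)

IsTree : Graph → Set
IsTree T = (1 ≤ size T) × Connected T × ¬ HasCycle T

record TreeDecomposition (F : Graph) : Set where
  field
    tree       : Graph
    isTree     : IsTree tree
    bag        : V tree → Subset (size F)
    vertexCov  : ∀ (v : V F) → ∃ λ t → v ∈ bag t
    edgeCov    : ∀ (v w : V F) → Adj F v w → ∃ λ t → (v ∈ bag t) × (w ∈ bag t)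
    connected  : ∀ (v : V F) (s t : V tree) → v ∈ bag s → v ∈ bag t →
                 PWalk tree (λ u → v ∈ bag u) s t

HasWidthAtMost : ∀ {F} → ℕ → TreeDecomposition F → Set
HasWidthAtMost k D = ∀ t → ∣ TreeDecomposition.bag D t ∣ ≤ suc k

TwAtMost : ℕ → Graph → Set
TwAtMost k F = Σ (TreeDecomposition F) (HasWidthAtMost k)

{-# OPTIONS --safe #-}

-- G and H are the Cai–Fürer–Immerman graphs over F, untwisted and twisted at one vertex u. A
-- homomorphism to a twisted graph is a map ψ to F together with a solution of a system of parity
-- equations over 𝔽₂; any fixed solution for ψ translates the lifts of ψ to one graph bijectively to
-- those to the other. For ψ = id the twisted system is unsolvable by the handshake lemma, whence
-- hom F G > hom F H.
--
-- If F has tree-width > k it has a haven β: the escape strategy of a robber against k + 1 cops. Fix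
-- ψ : F′ → F and a tree decomposition of F′ of width ≤ k. On the image of a bag, the twisted system
-- is solved by a path from u to the robber's position, and moving along an edge of the tree the
-- robber extends this path without using edges at vertices common to both bags. As there are no
-- cycles, these local solutions fit together, so hom F′ G = hom F′ H.
--
-- The haven is obtained from the duality between brambles and partitioning trees: start from the
-- edge sets that fit in a bag and declare further sets small as long as F has no partial tree
-- decomposition whose leaves are small. In the end any two large sets meet, since two disjoint ones
-- could be separated by a cut of least boundary along which their decompositions can be glued, and
-- β X is the component of F − X whose set of incident edges is large.

module Submission where

open import Defs renaming (sym to adj-sym; irrefl to adj-irrefl)
open import Algebra.Bundles using (CommutativeRing)
import Algebra.Properties.CommutativeMonoid.Sum as Sum
open import Data.Bool using (Bool; true; false; not; _∨_; _∧_; _xor_; if_then_else_)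
open import Data.Bool.ListAction using (and)
open import Data.Bool.Properties using
  ( _≟_; T?; T-≡; not-involutive; ¬-not; ∧-comm; ∧-zeroʳ; ∧-identityʳ; xor-assoc; xor-comm; xor-same
  ; xor-identityʳ; ∧-distribˡ-xor; xor-∧-commutativeRing)
open import Data.Fin as Fin using
  (Fin; zero; suc; toℕ; inject₁; fromℕ; combine; remQuot; funToFin; finToFun)
open import Data.Fin.Properties using
  ( any?; all?; ¬∀⟶∃¬; suc-injective; toℕ-inject₁; injective⇒≤; 2↔Bool; remQuot-combine; combine-remQuot
  ; finToFun-funToFin; funToFin-finToFin)
open import Data.Fin.Relation.Unary.Top using (view; ‵fromℕ; ‵inject₁)
open import Data.Fin.Subset using (Subset; _∈_; _∉_; _⊂_; _⊃_; _∪_; _─_; _-_; ⁅_⁆; ∣_∣)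
open import Data.Fin.Subset.Induction using (⊂-wellFounded; ⊃-wellFounded; Acc; acc)
open import Data.Fin.Subset.Properties using
  ( _∈?_; p⊆p∪q; q⊆p∪q; x∈p∪q⁻; x∈⁅x⁆; x∈⁅y⁆⇒x≡y; x∈p⇒p-x⊂p; x∈p∧x≢y⇒x∈p-y; p─q⊆p)
open import Data.List as List using (List; []; _∷_; map; filter; allFin)
open import Data.List.Membership.Propositional.Properties using (∈-allFin; ∈-lookup)
open import Data.List.Relation.Unary.All as All using (All; []; _∷_)
import Data.List.Relation.Unary.All.Properties as AllP
open import Data.List.Relation.Unary.AllPairs as AllPairs using (AllPairs; []; _∷_)
import Data.List.Relation.Unary.AllPairs.Properties as AllPairsP
open import Data.List.Relation.Unary.Any as Any using (Any; here; index)
import Data.List.Relation.Unary.Any.Properties as AnyP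
open import Data.List.Relation.Unary.Unique.Propositional.Properties using (allFin⁺)
open import Data.Nat using (ℕ; zero; suc; _+_; _*_; _^_; _≤_; _<_; _≤?_; z≤n; s≤s)
open import Data.Nat.Induction using (<-wellFounded)
import Data.Nat.Properties as ℕ
open import Data.Product using (Σ; ∃; ∃₂; _×_; _,_; proj₁; proj₂)
open import Data.Sum using (_⊎_; inj₁; inj₂)
open import Data.Unit using (tt)
open import Data.Vec using ([]; _∷_; lookup; tabulate; there)
import Data.Vec.Functional as VF
open import Data.Vec.Properties using ([]=⇒lookup; lookup⇒[]=; lookup∘tabulate)
open import Function using (_∘_; mk⇔; Equivalence; Inverse)
open import Level using (0ℓ)
open import Relation.Binary using (Rel; Symmetric)
open import Relation.Binary.PropositionalEquality
open import Relation.Nullary using (¬_; Dec; yes; no; does; contradiction; decidable-stable; ¬?)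
open import Relation.Nullary.Decidable using
  (_×-dec_; _⊎-dec_; _→-dec_; dec-true; dec-false; does-⇔)

-- Counting homomorphisms

IsHom : (F G : Graph) → (V F → V G) → Set
IsHom F G φ = ∀ i j → Adj F i j → Adj G (φ i) (φ j)

and-map⁺ : ∀ {A : Set} (p : A → Bool) xs → All (λ x → p x ≡ true) xs → and (map p xs) ≡ true
and-map⁺ p [] [] = refl
and-map⁺ p (x ∷ xs) (px ∷ pxs) rewrite px = and-map⁺ p xs pxs

and-map⁻ : ∀ {A : Set} (p : A → Bool) xs → and (map p xs) ≡ true → All (λ x → p x ≡ true) xs
and-map⁻ p [] _ = []
and-map⁻ p (x ∷ xs) eq with p x in px
... | true = px ∷ and-map⁻ p xs eq

isHomᵇ⁺ : ∀ F G {φ} → IsHom F G φ → isHomᵇ F G φ ≡ true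
isHomᵇ⁺ F G {φ} h = and-map⁺ _ (allFin _) (All.tabulate λ {i} _ → and-map⁺ _ (allFin _) (All.tabulate λ {j} _ → edge i j))
  where
  edge : ∀ i j → not (adj F i j) ∨ adj G (φ i) (φ j) ≡ true
  edge i j with adj F i j in e
  ... | true  = h i j e
  ... | false = refl

isHomᵇ⁻ : ∀ F G {φ} → isHomᵇ F G φ ≡ true → IsHom F G φ
isHomᵇ⁻ F G {φ} eq i j e
  with All.lookup (and-map⁻ _ (allFin _) (All.lookup (and-map⁻ _ (allFin _) eq) (∈-allFin i))) (∈-allFin j)
... | h rewrite e = h

-- Without function extensionality, a given map is found in the list only up to pointwise equality.
allMaps-complete : ∀ n m (f : Fin n → Fin m) → Any (_≗ f) (allMaps n m)
allMaps-complete zero    m f = here λ ()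
allMaps-complete (suc n) m f =
  AnyP.concatMap⁺ _ (Any.map
    (λ {g} g≗ → AnyP.map⁺ (Any.map (λ { refl zero → refl ; refl (suc i) → g≗ i }) (∈-allFin (f zero))))
    (allMaps-complete n m (f ∘ suc)))

allMaps-distinct : ∀ n m → AllPairs (λ f g → ¬ f ≗ g) (allMaps n m)
allMaps-distinct zero    m = [] ∷ []
allMaps-distinct (suc n) m = AllPairsP.concat⁺
  (AllP.map⁺ (All.tabulate λ {f} _ →
    AllPairsP.map⁺ (AllPairs.map (λ x≢y eq → x≢y (eq zero)) (allFin⁺ m))))
  (AllPairsP.map⁺ (AllPairs.map
    (λ f≢g → AllP.map⁺ (All.tabulate λ _ → AllP.map⁺ (All.tabulate λ _ eq → f≢g (eq ∘ suc))))
    (allMaps-distinct n m)))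

-- `AllPairs` compares an entry only with later ones; the symmetry of `R` covers indices in the
-- opposite order.
lookup-distinct : ∀ {A : Set} {R : Rel A 0ℓ} → Symmetric R → ∀ {xs} → AllPairs (λ x y → ¬ R x y) xs →
                  ∀ i j → R (List.lookup xs i) (List.lookup xs j) → i ≡ j
lookup-distinct symR (_  ∷ _)  zero    zero    _ = refl
lookup-distinct symR (px ∷ _)  zero    (suc j) r = contradiction r (All.lookup px (∈-lookup j))
lookup-distinct symR (px ∷ _)  (suc i) zero    r = contradiction (symR r) (All.lookup px (∈-lookup i))
lookup-distinct symR (_  ∷ ps) (suc i) (suc j) r = cong suc (lookup-distinct symR ps i j r)

-- The length of this list reduces to `hom F G`, so `Fin (hom F G)` indexes the homomorphisms.
homs : (F G : Graph) → List (V F → V G)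
homs F G = filter (λ φ → T? (isHomᵇ F G φ)) (allMaps (size F) (size G))

homs-sound : ∀ F G i → IsHom F G (List.lookup (homs F G) i)
homs-sound F G i = isHomᵇ⁻ F G (Equivalence.to T-≡
  (All.lookup (AllP.all-filter (λ φ → T? (isHomᵇ F G φ)) (allMaps (size F) (size G))) (∈-lookup i)))

homs-complete : ∀ F G φ → IsHom F G φ → ∃ λ i → List.lookup (homs F G) i ≗ φ
homs-complete F G φ h
  with allMaps-complete (size F) (size G) φ
... | p with AnyP.filter⁺ (λ ψ → T? (isHomᵇ F G ψ)) p
... | inj₁ q = index q , AnyP.lookup-index q
... | inj₂ ¬hom = contradiction (Equivalence.from T-≡ (isHomᵇ⁺ F G hom′)) ¬hom
  where
  hom′ : IsHom F G (Any.lookup p)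
  hom′ i j e = subst₂ (Adj G) (sym (AnyP.lookup-result p i)) (sym (AnyP.lookup-result p j)) (h i j e)

homs-distinct : ∀ F G i j → List.lookup (homs F G) i ≗ List.lookup (homs F G) j → i ≡ j
homs-distinct F G = lookup-distinct (λ eq x → sym (eq x))
  (AllPairsP.filter⁺ (λ φ → T? (isHomᵇ F G φ)) (allMaps-distinct (size F) (size G)))

module _ (F G H : Graph) (Φ : (V F → V G) → V F → V H)
         (Φ-hom : ∀ φ → IsHom F G φ → IsHom F H (Φ φ))
         (Φ-injective : ∀ φ ψ → IsHom F G φ → IsHom F G ψ → Φ φ ≗ Φ ψ → φ ≗ ψ) where

  private
    image : Fin (hom F G) → Fin (hom F H)
    image i = proj₁ (homs-complete F H _ (Φ-hom _ (homs-sound F G i)))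

    image-lookup : ∀ i → List.lookup (homs F H) (image i) ≗ Φ (List.lookup (homs F G) i)
    image-lookup i = proj₂ (homs-complete F H _ (Φ-hom _ (homs-sound F G i)))

    image-injective : ∀ {i j} → image i ≡ image j → i ≡ j
    image-injective {i} {j} eq = homs-distinct F G i j
      (Φ-injective _ _ (homs-sound F G i) (homs-sound F G j) λ x →
        trans (sym (image-lookup i x))
          (trans (cong (λ l → List.lookup (homs F H) l x) eq) (image-lookup j x)))

  hom-mono-≤ : hom F G ≤ hom F H
  hom-mono-≤ = injective⇒≤ image-injective

  hom-mono-< : ∀ χ → IsHom F H χ → (∀ φ → IsHom F G φ → ¬ Φ φ ≗ χ) → hom F G < hom F H
  -- The index of the missed `χ` is put in front of `image`, giving an injection from a set with one
  -- more element.
  hom-mono-< χ χ-hom missed = injective⇒≤ {f = j₀ VF.∷ image} λ {i} {j} → extended i j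
    where
    j₀ = proj₁ (homs-complete F H χ χ-hom)

    ≢image : ∀ i → j₀ ≢ image i
    ≢image i eq = missed _ (homs-sound F G i) λ x →
      trans (sym (image-lookup i x))
        (trans (cong (λ l → List.lookup (homs F H) l x) (sym eq)) (proj₂ (homs-complete F H χ χ-hom) x))

    extended : ∀ i j → (j₀ VF.∷ image) i ≡ (j₀ VF.∷ image) j → i ≡ j
    extended zero    zero    _  = refl
    extended zero    (suc j) eq = contradiction eq (≢image j)
    extended (suc i) zero    eq = contradiction (sym eq) (≢image i)
    extended (suc i) (suc j) eq = cong suc (image-injective eq)

-- Parity equations and havens

module Parity = Sum (CommutativeRing.+-commutativeMonoid xor-∧-commutativeRing)
module Total = Sum ℕ.+-0-commutativeMonoid

-- Coding Boolean functions by numbers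

funToFin-cong : ∀ {m n} {f g : Fin m → Fin n} → f ≗ g → funToFin f ≡ funToFin g
funToFin-cong {zero}  f≗g = refl
funToFin-cong {suc m} f≗g = cong₂ combine (f≗g zero) (funToFin-cong (f≗g ∘ suc))

-- The codes let `any?` and `all?` search through all Boolean functions, and let sets of such
-- functions be finite subsets.
encode : ∀ {n} → (Fin n → Bool) → Fin (2 ^ n)
encode f = funToFin (Inverse.from 2↔Bool ∘ f)

decode : ∀ n → Fin (2 ^ n) → Fin n → Bool
decode n i = Inverse.to 2↔Bool ∘ finToFun i

decode-encode : ∀ {n} (f : Fin n → Bool) → decode _ (encode f) ≗ f
decode-encode f x = trans
  (cong (Inverse.to 2↔Bool) (finToFun-funToFin (Inverse.from 2↔Bool ∘ f) x))
  (Inverse.strictlyInverseˡ 2↔Bool (f x))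

encode-decode : ∀ n (i : Fin (2 ^ n)) → encode (decode n i) ≡ i
encode-decode n i = trans
  (funToFin-cong λ x → Inverse.strictlyInverseʳ 2↔Bool (finToFun {2} {n} i x)) (funToFin-finToFin {n} i)

encode-cong : ∀ {n} {f g : Fin n → Bool} → f ≗ g → encode f ≡ encode g
encode-cong f≗g = funToFin-cong λ x → cong (Inverse.from 2↔Bool) (f≗g x)

encode₂ : ∀ {m n} → (Fin m → Fin n → Bool) → Fin ((2 ^ n) ^ m)
encode₂ f = funToFin (encode ∘ f)

decode₂ : ∀ m n → Fin ((2 ^ n) ^ m) → Fin m → Fin n → Bool
decode₂ m n i = decode n ∘ finToFun i

decode₂-encode₂ : ∀ {m n} (f : Fin m → Fin n → Bool) x y →
                  decode₂ m n (encode₂ f) x y ≡ f x y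
decode₂-encode₂ f x y = trans
  (cong (λ i → decode _ i y) (finToFun-funToFin (encode ∘ f) x)) (decode-encode (f x) y)

_==_ : ∀ {n} → Fin n → Fin n → Bool
x == y = does (x Fin.≟ y)

==-true : ∀ {n} (x y : Fin n) → x == y ≡ true → x ≡ y
==-true x y eq with x Fin.≟ y
... | yes x≡y = x≡y

==-refl : ∀ {n} (x : Fin n) → x == x ≡ true
==-refl x = dec-true (x Fin.≟ x) refl

==-false : ∀ {n} (x y : Fin n) → x ≢ y → x == y ≡ false
==-false x y = dec-false (x Fin.≟ y)

==-sym : ∀ {n} (x y : Fin n) → x == y ≡ y == x
==-sym x y with x Fin.≟ y
... | yes refl = sym (==-refl x)
... | no x≢y = sym (==-false y x (x≢y ∘ sym))

-- Parities and cardinalities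

parity : ∀ {n} → (Fin n → Bool) → Bool
parity = Parity.sum

parity-false : ∀ n → parity {n} (λ _ → false) ≡ false
parity-false = Parity.sum-replicate-zero

parity-single : ∀ {n} (f : Fin n → Bool) y → parity (λ x → f x ∧ (x == y)) ≡ f y
parity-single {suc n} f zero = begin
  (f zero ∧ true) xor parity (λ x → f (suc x) ∧ false)
    ≡⟨ cong₂ _xor_ (∧-comm (f zero) true) (Parity.sum-cong-≗ λ x → ∧-zeroʳ (f (suc x))) ⟩
  f zero xor parity {n} (λ _ → false) ≡⟨ cong (f zero xor_) (parity-false n) ⟩
  f zero xor false ≡⟨ xor-identityʳ _ ⟩
  f zero ∎
  where open ≡-Reasoning
parity-single {suc n} f (suc y) = cong₂ _xor_ (∧-zeroʳ (f zero)) (parity-single (f ∘ suc) y)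

-- The handshake lemma mod 2: off-diagonal entries cancel in pairs. The induction splits off the
-- first row and the first column, which have the same parity `p`.
parity-symmetric : ∀ {n} (a : Fin n → Fin n → Bool) → (∀ x y → a x y ≡ a y x) →
                   (∀ x → a x x ≡ false) → parity (λ x → parity (a x)) ≡ false
parity-symmetric {zero}  a symm diag = refl
parity-symmetric {suc n} a symm diag = begin
  (a zero zero xor p) xor parity (λ x → a (suc x) zero xor parity (a (suc x) ∘ suc))
    ≡⟨ cong₂ _xor_ (cong (_xor p) (diag zero))
         (trans (Parity.sum-cong-≗ λ x → cong (_xor parity (a (suc x) ∘ suc)) (symm (suc x) zero))
                (Parity.∑-distrib-+ (a zero ∘ suc) λ x → parity (a (suc x) ∘ suc))) ⟩
  p xor (p xor parity (λ x → parity (a (suc x) ∘ suc)))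
    ≡⟨ xor-assoc p p _ ⟨
  (p xor p) xor parity (λ x → parity (a (suc x) ∘ suc))
    ≡⟨ cong₂ _xor_ (xor-same p)
         (parity-symmetric (λ x y → a (suc x) (suc y)) (λ x y → symm (suc x) (suc y)) (diag ∘ suc)) ⟩
  false ∎
  where
  open ≡-Reasoning
  p = parity (a zero ∘ suc)

⟦_⟧ : Bool → ℕ
⟦ false ⟧ = 0
⟦ true ⟧  = 1

count : ∀ {n} → (Fin n → Bool) → ℕ
count f = Total.sum (⟦_⟧ ∘ f)

sum-mono-≤ : ∀ {n} {f g : Fin n → ℕ} → (∀ i → f i ≤ g i) → Total.sum f ≤ Total.sum g
sum-mono-≤ {zero}  f≤g = z≤n
sum-mono-≤ {suc n} f≤g = ℕ.+-mono-≤ (f≤g zero) (sum-mono-≤ (f≤g ∘ suc))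

⟦⟧-mono : ∀ a b → (a ≡ true → b ≡ true) → ⟦ a ⟧ ≤ ⟦ b ⟧
⟦⟧-mono false b    _   = z≤n
⟦⟧-mono true  b    a⇒b rewrite a⇒b refl = ℕ.≤-refl

count-mono : ∀ {n} (f g : Fin n → Bool) → (∀ x → f x ≡ true → g x ≡ true) → count f ≤ count g
count-mono f g f⊆g = sum-mono-≤ λ x → ⟦⟧-mono (f x) (g x) (f⊆g x)

count-cong : ∀ {n} {f g : Fin n → Bool} → f ≗ g → count f ≡ count g
count-cong f≗g = Total.sum-cong-≗ λ x → cong ⟦_⟧ (f≗g x)

f≤sum : ∀ {n} (f : Fin n → ℕ) x → f x ≤ Total.sum f
f≤sum f zero    = ℕ.m≤m+n _ _
f≤sum f (suc x) = ℕ.≤-trans (f≤sum (f ∘ suc) x) (ℕ.m≤n+m _ _)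

sum-zero : ∀ n → Total.sum {n} (λ _ → 0) ≡ 0
sum-zero = Total.sum-replicate-zero

count-singleton : ∀ {n} (y : Fin n) → count (_== y) ≡ 1
count-singleton {suc n} zero    = cong suc (sum-zero n)
count-singleton (suc y) = count-singleton y

image : ∀ {m n} → (Fin m → Fin n) → (Fin m → Bool) → Fin n → Bool
image f B y = does (any? λ x → (B x ≟ true) ×-dec (f x Fin.≟ y))

∈-image : ∀ {m n} (f : Fin m → Fin n) B {x} → B x ≡ true → image f B (f x) ≡ true
∈-image f B {x} Bx = dec-true (any? _) (x , Bx , refl)

-- Double counting of the pairs of an `x` in `B` and its value: each point of the image occurs in at
-- least one pair, each `x` in exactly one.
count-image-≤ : ∀ {m n} (f : Fin m → Fin n) B → count (image f B) ≤ count B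
count-image-≤ {m} {n} f B = begin
  count (image f B)                                             ≤⟨ sum-mono-≤ fibre ⟩
  Total.sum {n} (λ y → Total.sum {m} λ x → ⟦ B x ∧ (y == f x) ⟧)  ≡⟨ Total.∑-comm (λ y x → ⟦ B x ∧ (y == f x) ⟧) ⟩
  Total.sum {m} (λ x → Total.sum {n} λ y → ⟦ B x ∧ (y == f x) ⟧)  ≤⟨ sum-mono-≤ (λ x → single (B x) (f x)) ⟩
  count B                                                       ∎
  where
  open ℕ.≤-Reasoning
  fibre : ∀ y → ⟦ image f B y ⟧ ≤ Total.sum (λ x → ⟦ B x ∧ (y == f x) ⟧)
  fibre y with any? (λ x → (B x ≟ true) ×-dec (f x Fin.≟ y))
  ... | no _ = z≤n
  ... | yes (x , Bx , refl) = ℕ.≤-trans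
    (ℕ.≤-reflexive (sym (cong₂ (λ a b → ⟦ a ∧ b ⟧) Bx (==-refl (f x)))))
    (f≤sum (λ x′ → ⟦ B x′ ∧ (f x == f x′) ⟧) x)
  single : ∀ b (z : Fin n) → Total.sum (λ y → ⟦ b ∧ (y == z) ⟧) ≤ ⟦ b ⟧
  single false z = ℕ.≤-reflexive (sum-zero n)
  single true  z = ℕ.≤-reflexive (count-singleton z)

-- Links between vertices, and havens

module Links (F : Graph) where

  private
    n = size F

  -- The number mod 2 of neighbours of `v` marked in row `v` of `p`; entries at non-edges of `F` are
  -- masked out.
  degree : (Fin n → Fin n → Bool) → Fin n → Bool
  degree p v = parity λ w → adj F v w ∧ p v w

  degree-cong : ∀ p q v → p v ≗ q v → degree p v ≡ degree q v
  degree-cong p q v eq = Parity.sum-cong-≗ λ w → cong (adj F v w ∧_) (eq w)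

  degree-false : ∀ p v → p v ≗ (λ _ → false) → degree p v ≡ false
  degree-false p v eq = trans
    (Parity.sum-cong-≗ λ w → trans (cong (adj F v w ∧_) (eq w)) (∧-zeroʳ (adj F v w)))
    (parity-false n)

  degree-xor : ∀ p q v → degree (λ v w → p v w xor q v w) v ≡ degree p v xor degree q v
  degree-xor p q v = trans
    (Parity.sum-cong-≗ λ w → ∧-distribˡ-xor (adj F v w) (p v w) (q v w))
    (Parity.∑-distrib-+ (λ w → adj F v w ∧ p v w) (λ w → adj F v w ∧ q v w))

  -- A join of `r` and `s`: an edge set without edges at `Y` whose degrees are odd exactly at `r`
  -- and `s`, and all even if `r` equals `s`.
  IsLink : (Fin n → Bool) → Fin n → Fin n → (Fin n → Fin n → Bool) → Set
  IsLink Y r s p =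
      (∀ v w → p v w ≡ p w v)
    × (∀ v → degree p v ≡ (v == r) xor (v == s))
    × (∀ v w → Y v ≡ true → p v w ≡ false)

  -- Equivalent to r and s being joined by a walk outside Y, but decidable by a finite search and
  -- directly usable as a correction of a solution of the parity equations.
  Linked : (Fin n → Bool) → Fin n → Fin n → Set
  Linked Y r s = ∃ λ i → IsLink Y r s (decode₂ n n i)

  linked? : ∀ Y r s → Dec (Linked Y r s)
  linked? Y r s = any? λ i →
          all? (λ v → all? λ w → decode₂ n n i v w ≟ decode₂ n n i w v)
    ×-dec all? (λ v → degree (decode₂ n n i) v ≟ (v == r) xor (v == s))
    ×-dec all? (λ v → all? λ w → (Y v ≟ true) →-dec (decode₂ n n i v w ≟ false))

  link : ∀ {Y r s} p → IsLink Y r s p → Linked Y r s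
  link p (symm , deg , avoid) = encode₂ p
    , (λ v w → trans (eq v w) (trans (symm v w) (sym (eq w v))))
    , (λ v → trans (degree-cong (decode₂ n n (encode₂ p)) p v (eq v)) (deg v))
    , (λ v w Yv → trans (eq v w) (avoid v w Yv))
    where eq = decode₂-encode₂ p

  linked-refl : ∀ Y r → Linked Y r r
  linked-refl Y r = link (λ _ _ → false)
    ( (λ _ _ → refl)
    , (λ v → trans (degree-false _ v λ _ → refl) (sym (xor-same (v == r))))
    , (λ _ _ _ → refl))

  linked-sym : ∀ {Y r s} → Linked Y r s → Linked Y s r
  linked-sym (i , symm , deg , avoid) = i , symm , (λ v → trans (deg v) (xor-comm (v == _) (v == _))) , avoid

  xor-telescope : ∀ a b c → (a xor b) xor (b xor c) ≡ a xor c
  xor-telescope a b c = trans (xor-assoc a b (b xor c))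
    (cong (a xor_) (trans (sym (xor-assoc b b c)) (cong (_xor c) (xor-same b))))

  -- In the symmetric difference of the two links the odd degrees at `s` cancel.
  linked-trans : ∀ {Y r s t} → Linked Y r s → Linked Y s t → Linked Y r t
  linked-trans {Y} {r} {s} {t} (i , symm , deg , avoid) (i′ , symm′ , deg′ , avoid′) =
    link (λ v w → decode₂ n n i v w xor decode₂ n n i′ v w)
      ( (λ v w → cong₂ _xor_ (symm v w) (symm′ v w))
      , (λ v → trans (degree-xor (decode₂ n n i) (decode₂ n n i′) v)
                 (trans (cong₂ _xor_ (deg v) (deg′ v)) (xor-telescope (v == r) (v == s) (v == t))))
      , (λ v w Yv → cong₂ _xor_ (avoid v w Yv) (avoid′ v w Yv)))

  linked-mono : ∀ {Y Y′ r s} → (∀ v → Y v ≡ true → Y′ v ≡ true) → Linked Y′ r s → Linked Y r s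
  linked-mono Y⊆Y′ (i , symm , deg , avoid) = i , symm , deg , λ v w Yv → avoid v w (Y⊆Y′ v Yv)

  -- The edge `rs` alone is the link. It is written as a sum of two arcs, each contributing to the
  -- degree of its tail only.
  linked-adj : ∀ {Y r s} → Adj F r s → Y r ≡ false → Y s ≡ false → Linked Y r s
  linked-adj {Y} {r} {s} rs Yr Ys = link p (symm , deg , avoid)
    where
    p : Fin n → Fin n → Bool
    p v w = ((v == r) ∧ (w == s)) xor ((v == s) ∧ (w == r))

    symm : ∀ v w → p v w ≡ p w v
    symm v w = trans (xor-comm ((v == r) ∧ (w == s)) _)
      (cong₂ _xor_ (∧-comm (v == s) (w == r)) (∧-comm (v == r) (w == s)))

    arc-degree : ∀ a b → Adj F a b → ∀ v → degree (λ v w → (v == a) ∧ (w == b)) v ≡ v == a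
    arc-degree a b ab v with v Fin.≟ a
    ... | yes refl = trans (parity-single (adj F v) b) ab
    ... | no _ = degree-false (λ _ _ → false) v λ _ → refl

    deg : ∀ v → degree p v ≡ (v == r) xor (v == s)
    deg v = trans (degree-xor (λ v w → (v == r) ∧ (w == s)) (λ v w → (v == s) ∧ (w == r)) v)
      (cong₂ _xor_ (arc-degree r s rs v) (arc-degree s r (trans (adj-sym F s r) rs) v))

    avoid : ∀ v w → Y v ≡ true → p v w ≡ false
    avoid v w Yv = cong₂ (λ a b → (a ∧ (w == s)) xor (b ∧ (w == r))) (outside Yr) (outside Ys)
      where
      outside : ∀ {x} → Y x ≡ false → v == x ≡ false
      outside {x} Yx = ==-false v x λ { refl → contradiction (trans (sym Yv) Yx) λ () }

  infixr 7 _∩_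
  _∩_ : (Fin n → Bool) → (Fin n → Bool) → Fin n → Bool
  (X ∩ Y) v = X v ∧ Y v

  -- The robber's strategy, with each component represented by one of its vertices. When the cops
  -- move from `X` to `Y`, only those on `X ∩ Y` stay in place, and `joined` lets the robber run
  -- past them.
  record Haven (k : ℕ) : Set where
    field
      at     : (Fin n → Bool) → Fin n
      avoids : ∀ X → count X ≤ suc k → X (at X) ≡ false
      joined : ∀ X Y → count X ≤ suc k → count Y ≤ suc k → Linked (X ∩ Y) (at X) (at Y)

  private
    IsHaven : ℕ → (Fin (2 ^ n) → Fin n) → Set
    IsHaven k β = ∀ i → count (decode n i) ≤ suc k → decode n i (β i) ≡ false
      × (∀ j → count (decode n j) ≤ suc k → Linked (decode n i ∩ decode n j) (β i) (β j))

    isHaven? : ∀ k β → Dec (IsHaven k β)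
    isHaven? k β = all? λ i → (count (decode n i) ≤? suc k) →-dec ((decode n i (β i) ≟ false)
      ×-dec all? λ j → (count (decode n j) ≤? suc k) →-dec linked? _ _ _)

    fromCode : ∀ {k} → ∃ (λ c → IsHaven k (finToFun c)) → Haven k
    fromCode {k} (c , h) = record
      { at     = β ∘ encode
      ; avoids = λ X small → trans (sym (decode-encode X _)) (proj₁ (h (encode X) (small-code X small)))
      ; joined = λ X Y sX sY → linked-mono (λ v e → trans (cong₂ _∧_ (decode-encode X v) (decode-encode Y v)) e)
                   (proj₂ (h (encode X) (small-code X sX)) (encode Y) (small-code Y sY))
      }
      where
      β = finToFun c
      small-code : ∀ X → count X ≤ suc k → count (decode n (encode X)) ≤ suc k
      small-code X = ℕ.≤-trans (ℕ.≤-reflexive (count-cong (decode-encode X)))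

    toCode : ∀ {k} → Haven k → ∃ (λ c → IsHaven k (finToFun c))
    toCode H = funToFin β , λ i si →
        trans (cong (decode n i) (eq i)) (avoids (decode n i) si)
      , λ j sj → subst₂ (Linked _) (sym (eq i)) (sym (eq j)) (joined (decode n i) (decode n j) si sj)
      where
      open Haven H
      β = at ∘ decode n
      eq = finToFun-funToFin β

  -- There are finitely many coded strategies, and being a haven is decidable for them, so a haven
  -- may be found by contradiction.
  haven-stable : ∀ {k} → ¬ ¬ Haven k → Haven k
  haven-stable {k} ¬¬haven = fromCode (decidable-stable (any? λ c → isHaven? k (finToFun c))
    λ ¬code → ¬¬haven (¬code ∘ toCode))

-- Cai–Fürer–Immerman graphs

does-true : ∀ {A : Set} (A? : Dec A) → does A? ≡ true → A
does-true (yes a) _ = a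

module CFI (F : Graph) where

  open Links F public

  private
    n = size F

  -- A vertex of a CFI graph is a pair of a vertex of `F` and a function on all of `V F`. Functions
  -- that agree on the neighbours of the base vertex give twins.
  base : Fin (n * 2 ^ n) → Fin n
  base x = proj₁ (remQuot {n} (2 ^ n) x)

  val : Fin (n * 2 ^ n) → Fin n → Bool
  val x = decode n (proj₂ (remQuot {n} (2 ^ n) x))

  vert : Fin n → (Fin n → Bool) → Fin (n * 2 ^ n)
  vert v f = combine v (encode f)

  base-vert : ∀ v f → base (vert v f) ≡ v
  base-vert v f = cong proj₁ (remQuot-combine v (encode f))

  val-vert : ∀ v f → val (vert v f) ≗ f
  val-vert v f w = trans (cong (λ rq → decode n (proj₂ rq) w) (remQuot-combine v (encode f)))
                         (decode-encode f w)

  vert-η : ∀ x → vert (base x) (val x) ≡ x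
  vert-η x = trans (cong (combine (base x)) (encode-decode n (proj₂ (remQuot {n} (2 ^ n) x))))
                   (combine-remQuot {n} (2 ^ n) x)

  vert-cong : ∀ {v w f g} → v ≡ w → f ≗ g → vert v f ≡ vert w g
  vert-cong v≡w f≗g = cong₂ combine v≡w (encode-cong f≗g)

  weight : (Fin n → Bool) → Fin n → Bool
  weight f = degree (λ _ → f)

  -- Two pairs over an edge of `F` are adjacent if they assign it the same value; `U` prescribes the
  -- parity of the values around each vertex.
  CFIAdj : (U : Fin n → Bool) (x y : Fin (n * 2 ^ n)) → Set
  CFIAdj U x y =
      weight (val x) (base x) ≡ U (base x)
    × weight (val y) (base y) ≡ U (base y)
    × Adj F (base x) (base y)
    × val x (base y) ≡ val y (base x)

  cfiAdj? : ∀ U x y → Dec (CFIAdj U x y)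
  cfiAdj? U x y =
          (weight (val x) (base x) ≟ U (base x))
    ×-dec (weight (val y) (base y) ≟ U (base y))
    ×-dec (adj F (base x) (base y) ≟ true)
    ×-dec (val x (base y) ≟ val y (base x))

  cfiAdj-sym : ∀ U {x y} → CFIAdj U x y → CFIAdj U y x
  cfiAdj-sym U {x} {y} (wx , wy , xy , eq) = wy , wx , trans (adj-sym F (base y) (base x)) xy , sym eq

  -- Pairs of the wrong weight stay in the graph as isolated vertices, so that every twist U has
  -- the same vertex set.
  cfi : (Fin n → Bool) → Graph
  cfi U = record
    { size   = n * 2 ^ n
    ; adj    = λ x y → does (cfiAdj? U x y)
    ; sym    = λ x y → does-⇔ (mk⇔ (cfiAdj-sym U) (cfiAdj-sym U)) (cfiAdj? U x y) (cfiAdj? U y x)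
    ; irrefl = λ x → dec-false (cfiAdj? U x x) λ (_ , _ , xx , _) →
        contradiction (trans (sym xx) (adj-irrefl F (base x))) λ ()
    }

  cfiAdj-vert : ∀ U {v w f g} → weight f v ≡ U v → weight g w ≡ U w → Adj F v w → f w ≡ g v →
                CFIAdj U (vert v f) (vert w g)
  cfiAdj-vert U {v} {w} {f} {g} wf wg vw eq
    rewrite base-vert v f | base-vert w g =
      trans (degree-cong (λ _ → val (vert v f)) (λ _ → f) v (val-vert v f)) wf
    , trans (degree-cong (λ _ → val (vert w g)) (λ _ → g) w (val-vert w g)) wg
    , vw
    , trans (val-vert v f w) (trans eq (sym (val-vert w g v)))

  module Shift (F′ : Graph) (U U′ : Fin n → Bool) where

    -- The equations for the difference of a lift of `ψ` to `cfi U` and one to `cfi U′`. They are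
    -- imposed along edges of `F′`, so an isolated vertex is unconstrained.
    IsShift : (V F′ → Fin n) → (V F′ → Fin n → Bool) → Set
    IsShift ψ x = ∀ a b → Adj F′ a b →
      weight (x a) (ψ a) ≡ U (ψ a) xor U′ (ψ a) × x a (ψ b) ≡ x b (ψ a)

    isShift? : ∀ ψ x → Dec (IsShift ψ x)
    isShift? ψ x = all? λ a → all? λ b → (adj F′ a b ≟ true) →-dec
      ((weight (x a) (ψ a) ≟ U (ψ a) xor U′ (ψ a)) ×-dec (x a (ψ b) ≟ x b (ψ a)))

    isShift-cong : ∀ {ψ ψ′ x x′} → ψ ≗ ψ′ → (∀ a w → x a w ≡ x′ a w) → IsShift ψ x → IsShift ψ′ x′
    isShift-cong {ψ} {ψ′} {x} {x′} ψ≗ x≗ sh a b ab with sh a b ab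
    ... | wt , eq rewrite sym (ψ≗ a) | sym (ψ≗ b) =
        trans (degree-cong (λ _ → x′ a) (λ _ → x a) (ψ a) (λ w → sym (x≗ a w))) wt
      , trans (sym (x≗ a (ψ b))) (trans eq (x≗ b (ψ a)))

    -- The shift may depend on φ only through the projection base ∘ φ; otherwise φ ↦ φ + shift
    -- would not be injective.
    canonical : Fin (n ^ size F′) → V F′ → Fin n → Bool
    canonical c with any? (λ i → isShift? (finToFun c) (decode₂ (size F′) n i))
    ... | yes (i , _) = decode₂ (size F′) n i
    ... | no _        = λ _ _ → false

    canonical-isShift : ∀ ψ x → IsShift ψ x → IsShift ψ (canonical (funToFin ψ))
    canonical-isShift ψ x sh
      with any? (λ i → isShift? (finToFun (funToFin ψ)) (decode₂ (size F′) n i))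
    ... | yes (i , sh′) = isShift-cong (finToFun-funToFin ψ) (λ _ _ → refl) sh′
    ... | no ¬sh = contradiction
      (encode₂ x , isShift-cong (λ a → sym (finToFun-funToFin ψ a))
                                (λ a w → sym (decode₂-encode₂ x a w)) sh)
      ¬sh

    shifted : (V F′ → V (cfi U)) → V F′ → V (cfi U′)
    shifted φ a = vert (base (φ a)) λ w → val (φ a) w xor canonical (funToFin (base ∘ φ)) a w

    base-shifted : ∀ φ a → base (shifted φ a) ≡ base (φ a)
    base-shifted φ a = base-vert (base (φ a)) _

    shifted-injective : ∀ φ ψ → shifted φ ≗ shifted ψ → φ ≗ ψ
    shifted-injective φ ψ eq a = trans (sym (vert-η (φ a))) (trans (vert-cong (bases a) vals) (vert-η (ψ a)))
      where
      bases : base ∘ φ ≗ base ∘ ψ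
      bases a = trans (sym (base-shifted φ a)) (trans (cong base (eq a)) (base-shifted ψ a))
      cφ = canonical (funToFin (base ∘ φ))
      cψ = canonical (funToFin (base ∘ ψ))
      sums : ∀ w → val (φ a) w xor cφ a w ≡ val (ψ a) w xor cφ a w
      sums w = trans (sym (val-vert (base (φ a)) _ w)) (trans (cong (λ x → val x w) (eq a))
        (trans (val-vert (base (ψ a)) _ w)
          (cong (λ c → val (ψ a) w xor canonical c a w) (funToFin-cong (sym ∘ bases)))))
      xor-cancel : ∀ b c d → b xor d ≡ c xor d → b ≡ c
      xor-cancel b c d e = trans (sym (undo b)) (trans (cong (_xor d) e) (undo c))
        where
        undo : ∀ b → (b xor d) xor d ≡ b
        undo b = trans (xor-assoc b d d) (trans (cong (b xor_) (xor-same d)) (xor-identityʳ b))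
      vals : val (φ a) ≗ val (ψ a)
      vals w = xor-cancel _ _ (cφ a w) (sums w)

    module _ (shift : ∀ φ → IsHom F′ (cfi U) φ → ∃ λ x → IsShift (base ∘ φ) x) where

      shifted-isHom : ∀ φ → IsHom F′ (cfi U) φ → IsHom F′ (cfi U′) (shifted φ)
      shifted-isHom φ hφ a b ab
        with does-true (cfiAdj? U (φ a) (φ b)) (hφ a b ab)
           | canonical-isShift (base ∘ φ) (proj₁ (shift φ hφ)) (proj₂ (shift φ hφ))
      ... | wa , wb , ad , eq | sh = dec-true (cfiAdj? U′ _ _)
        (cfiAdj-vert U′ (wt a wa (proj₁ (sh a b ab)))
                        (wt b wb (proj₁ (sh b a (trans (adj-sym F′ b a) ab)))) ad
          (cong₂ _xor_ eq (proj₂ (sh a b ab))))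
        where
        c = canonical (funToFin (base ∘ φ))
        wt : ∀ a → weight (val (φ a)) (base (φ a)) ≡ U (base (φ a)) →
             weight (c a) (base (φ a)) ≡ U (base (φ a)) xor U′ (base (φ a)) →
             weight (λ w → val (φ a) w xor c a w) (base (φ a)) ≡ U′ (base (φ a))
        wt a w₁ w₂ = trans (degree-xor (λ _ → val (φ a)) (λ _ → c a) (base (φ a)))
          (trans (cong₂ _xor_ w₁ w₂) (xor-telescope false (U (base (φ a))) (U′ (base (φ a)))))

      hom-cfi-≤ : hom F′ (cfi U) ≤ hom F′ (cfi U′)
      hom-cfi-≤ = hom-mono-≤ F′ (cfi U) (cfi U′) shifted shifted-isHom
        (λ φ ψ _ _ → shifted-injective φ ψ)

      -- Shifting preserves the projection to `F`, so a `χ` whose projection has no lift to `cfi U`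
      -- is not hit.
      hom-cfi-< : ∀ χ → IsHom F′ (cfi U′) χ → (∀ φ → IsHom F′ (cfi U) φ → ¬ base ∘ φ ≗ base ∘ χ) →
                  hom F′ (cfi U) < hom F′ (cfi U′)
      hom-cfi-< χ hχ unlifted = hom-mono-< F′ (cfi U) (cfi U′) shifted shifted-isHom
        (λ φ ψ _ _ → shifted-injective φ ψ) χ hχ
        λ φ hφ eq → unlifted φ hφ λ a → trans (sym (base-shifted φ a)) (cong base (eq a))

  untwisted : Fin n → Bool
  untwisted _ = false

  base-isHom : ∀ F′ U φ → IsHom F′ (cfi U) φ → IsHom F′ F (base ∘ φ)
  base-isHom F′ U φ hφ a b ab = proj₁ (proj₂ (proj₂ (does-true (cfiAdj? U (φ a) (φ b)) (hφ a b ab))))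

  -- With all values `false`, the projection of `φ` lifts to the untwisted graph; the values of `φ`
  -- are its difference from that lift.
  own-shift : ∀ F′ U φ → IsHom F′ (cfi U) φ → Shift.IsShift F′ U untwisted (base ∘ φ) (val ∘ φ)
  own-shift F′ U φ hφ a b ab with does-true (cfiAdj? U (φ a) (φ b)) (hφ a b ab)
  ... | wa , _ , _ , eq = trans wa (sym (xor-identityʳ (U (base (φ a))))) , eq

  -- The hypothesis gives one inequality; for the other, each homomorphism to `cfi U` brings its own
  -- shift.
  hom-cfi-≡ : ∀ F′ U → (∀ ψ → IsHom F′ F ψ → ∃ λ x → Shift.IsShift F′ untwisted U ψ x) →
              hom F′ (cfi untwisted) ≡ hom F′ (cfi U)
  hom-cfi-≡ F′ U shift = ℕ.≤-antisym
    (Shift.hom-cfi-≤ F′ untwisted U λ φ hφ → shift (base ∘ φ) (base-isHom F′ untwisted φ hφ))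
    (Shift.hom-cfi-≤ F′ U untwisted λ φ hφ → val ∘ φ , own-shift F′ U φ hφ)

  -- Summing the weights of a lift of the identity counts every edge twice, but they add up to 1.
  hom-cfi-≢ : ∀ u {v} → Adj F u v → hom F (cfi untwisted) ≢ hom F (cfi (_== u))
  hom-cfi-≢ u {u′} uu′ eq = ℕ.<⇒≢
    (Shift.hom-cfi-< F (_== u) untwisted (λ φ hφ → val ∘ φ , own-shift F (_== u) φ hφ)
      χ χ-isHom no-lift)
    (sym eq)
    where
    χ : Fin n → V (cfi untwisted)
    χ v = vert v untwisted

    χ-isHom : IsHom F (cfi untwisted) χ
    χ-isHom v w vw = dec-true (cfiAdj? untwisted _ _) (cfiAdj-vert untwisted
      (degree-false _ v λ _ → refl) (degree-false _ w λ _ → refl) vw refl)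

    no-lift : ∀ φ → IsHom F (cfi (_== u)) φ → ¬ base ∘ φ ≗ base ∘ χ
    no-lift φ hφ lift = contradiction (trans (sym total-even) total-odd) λ ()
      where
      over : ∀ v → base (φ v) ≡ v
      over v = trans (lift v) (base-vert v untwisted)

      facts : ∀ v w → Adj F v w → weight (val (φ v)) v ≡ v == u × val (φ v) w ≡ val (φ w) v
      facts v w vw with own-shift F (_== u) φ hφ v w vw
      ... | wt , e rewrite over v | over w = trans wt (xor-identityʳ (v == u)) , e

      a : Fin n → Fin n → Bool
      a v w = adj F v w ∧ val (φ v) w

      a-sym : ∀ v w → a v w ≡ a w v
      a-sym v w with adj F v w in vw
      ... | true  rewrite trans (adj-sym F w v) vw = proj₂ (facts v w vw)
      ... | false rewrite trans (adj-sym F w v) vw = refl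

      row : ∀ v → parity (a v) ≡ v == u
      row v with any? (λ w → adj F v w ≟ true)
      ... | yes (w , vw) = proj₁ (facts v w vw)
      -- The equation at `v` comes from an edge at `v`. An isolated `v` has a zero row and differs
      -- from `u`, which has the neighbour `u′`.
      ... | no isolated = trans
        (trans (Parity.sum-cong-≗ zeros) (parity-false n))
        (sym (==-false v u λ { refl → isolated (u′ , uu′) }))
        where
        zeros : ∀ w → a v w ≡ false
        zeros w with adj F v w in vw
        ... | true  = contradiction (w , vw) isolated
        ... | false = refl

      total-even : parity (λ v → parity (a v)) ≡ false
      total-even = parity-symmetric a a-sym λ v → cong (_∧ val (φ v) v) (adj-irrefl F v)

      total-odd : parity (λ v → parity (a v)) ≡ true
      total-odd = trans (Parity.sum-cong-≗ row) (parity-single (λ _ → true) u)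

-- Solving the parity equations along a tree decomposition

module Walks (G : Graph) where

  start : ∀ {P x y} → PWalk G P x y → P x
  start (stop Px)     = Px
  start (step Px _ _) = Px

  map-walk : ∀ {P Q x y} → (∀ {v} → P v → Q v) → PWalk G P x y → PWalk G Q x y
  map-walk f (stop Px)     = stop (f Px)
  map-walk f (step Px a w) = step (f Px) a (map-walk f w)

  _++ʷ_ : ∀ {P x y z} → PWalk G P x y → PWalk G P y z → PWalk G P x z
  stop _      ++ʷ w′ = w′
  step Px a w ++ʷ w′ = step Px a (w ++ʷ w′)

  reverse : ∀ {P x y} → PWalk G P x y → PWalk G P y x
  reverse (stop Px) = stop Px
  reverse (step {x} {y} Px a w) = reverse w ++ʷ step (start w) (trans (adj-sym G y x) a) (stop Px)

  record Path (P : V G → Set) (x y : V G) : Set where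
    field
      {len}     : ℕ
      at        : Fin (suc len) → V G
      injective : ∀ {i j} → at i ≡ at j → i ≡ j
      within    : ∀ i → P (at i)
      edges     : ∀ i → Adj G (at (inject₁ i)) (at (suc i))
      first     : at zero ≡ x
      last      : at (fromℕ len) ≡ y

  open Path

  suffix : ∀ {P x y} (p : Path P x y) i → Path P (at p i) y
  suffix p zero = record { at = at p ; injective = injective p ; within = within p
                         ; edges = edges p ; first = refl ; last = last p }
  suffix record { len = suc l ; at = at ; injective = inj ; within = wi ; edges = ed ; last = la } (suc i) =
    suffix record { at = at ∘ suc ; injective = suc-injective ∘ inj ; within = wi ∘ suc
                  ; edges = ed ∘ suc ; first = refl ; last = la } i

  -- If the first vertex of the walk already lies on the path found for the rest, the path is cut
  -- down to its suffix from there.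
  path : ∀ {P x y} → PWalk G P x y → Path P x y
  path {x = x} (stop Px) = record
    { len = 0 ; at = λ _ → x ; injective = λ { {zero} {zero} _ → refl } ; within = λ _ → Px
    ; edges = λ () ; first = refl ; last = refl }
  path {P} {x} {z} (step Px a w) with path w
  ... | p with any? (λ i → at p i Fin.≟ x)
  ... | yes (i , eq) = subst (λ v → Path P v z) eq (suffix p i)
  ... | no new = record
    { at = x VF.∷ at p
    ; injective = λ {i} {j} → inj i j
    ; within = λ { zero → Px ; (suc i) → within p i }
    ; edges = λ { zero → trans (cong (adj G x) (first p)) a ; (suc i) → edges p i }
    ; first = refl
    ; last = last p }
    where
    inj : ∀ i j → (x VF.∷ at p) i ≡ (x VF.∷ at p) j → i ≡ j
    inj zero    zero    _  = refl
    inj zero    (suc j) eq = contradiction (j , sym eq) new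
    inj (suc i) zero    eq = contradiction (i , eq) new
    inj (suc i) (suc j) eq = cong suc (injective p eq)

  -- Since `x ≢ y`, a path between them has at least two vertices, and `t`, lying outside `P`, makes
  -- a third.
  close-cycle : ∀ {P x y t} → PWalk G P x y → x ≢ y → ¬ P t → Adj G t x → Adj G t y → HasCycle G
  close-cycle {P} {x} {y} {t} w x≢y ¬Pt tx ty with path w
  ... | record { len = zero  ; first = f ; last = l } = contradiction (trans (sym f) l) x≢y
  ... | p@record { len = suc l } = l , t VF.∷ at p , (λ {i} {j} → inj i j)
      , (λ { zero → trans (cong (adj G t) (first p)) tx ; (suc i) → edges p i })
      , trans (cong (λ v → adj G v t) (last p)) (trans (adj-sym G y t) ty)
    where
    t≢ : ∀ i → t ≢ at p i
    t≢ i eq = ¬Pt (subst P (sym eq) (within p i))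
    inj : ∀ i j → (t VF.∷ at p) i ≡ (t VF.∷ at p) j → i ≡ j
    inj zero    zero    _  = refl
    inj zero    (suc j) eq = contradiction eq (t≢ j)
    inj (suc i) zero    eq = contradiction (sym eq) (t≢ i)
    inj (suc i) (suc j) eq = cong suc (injective p eq)

  crossing : ∀ {Q x y} (S : Subset (size G)) → PWalk G Q x y → x ∈ S → y ∉ S →
             ∃ λ s → ∃ λ t → s ∈ S × t ∉ S × Adj G s t
  crossing S (stop _) x∈S y∉S = contradiction x∈S y∉S
  crossing S (step {x} {y} _ a w) x∈S z∉S with y ∈? S
  ... | yes y∈S = crossing S w y∈S z∉S
  ... | no  y∉S = x , y , x∈S , y∉S , a

-- Compatible choices along a tree

module _ (T : Graph) (connected : Connected T) (acyclic : ¬ HasCycle T)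
         {Y : Set} (Good : V T → Y → Set) (R : V T → V T → Y → Y → Set)
         (R-sym : ∀ {s t y z} → R s t y z → R t s z y)
         (extend : ∀ s t → Adj T s t → ∀ y → Good s y → ∃ λ z → Good t z × R s t y z)
         where

  open Walks T

  -- The choice is extended from `root` by one adjacent vertex at a time. The new vertex has only
  -- one neighbour in the connected set already treated, as a second one would close a cycle, so
  -- only one compatibility has to be met.
  tree-section : ∀ root y₀ → Good root y₀ →
    ∃ λ (σ : V T → Y) → (∀ t → Good t (σ t)) × (∀ s t → Adj T s t → R s t (σ s) (σ t))
  tree-section root y₀ good₀ = grow ⁅ root ⁆ (⊃-wellFounded _) (x∈⁅x⁆ root) (λ _ → y₀)
    (λ s s∈ → subst (PWalk T (_∈ ⁅ root ⁆) root) (sym (x∈⁅y⁆⇒x≡y root s∈)) (stop (x∈⁅x⁆ root)))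
    (λ s s∈ → subst (λ s → Good s y₀) (sym (x∈⁅y⁆⇒x≡y root s∈)) good₀)
    (λ s t s∈ t∈ st → contradiction
      (trans (sym (adj-irrefl T root)) (subst₂ (Adj T) (x∈⁅y⁆⇒x≡y root s∈) (x∈⁅y⁆⇒x≡y root t∈) st)) λ ())
    where
    grow : (S : Subset (size T)) → Acc _⊃_ S → root ∈ S → (σ : V T → Y) →
           (∀ s → s ∈ S → PWalk T (_∈ S) root s) → (∀ s → s ∈ S → Good s (σ s)) →
           (∀ s t → s ∈ S → t ∈ S → Adj T s t → R s t (σ s) (σ t)) →
           ∃ λ (σ : V T → Y) → (∀ t → Good t (σ t)) × (∀ s t → Adj T s t → R s t (σ s) (σ t))
    grow S (acc rec) root∈S σ walks good compat with all? (_∈? S)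
    ... | yes all = σ , (λ t → good t (all t)) , λ s t → compat s t (all s) (all t)
    ... | no ¬all
      with t₀ , t₀∉S ← ¬∀⟶∃¬ _ _ (_∈? S) ¬all
      with s , t , s∈S , t∉S , st ← crossing S (connected root t₀) root∈S t₀∉S
      with z , good-z , Rz ← extend s t st (σ s) (good s s∈S)
      = grow S′ (rec (p⊆p∪q ⁅ t ⁆ , t , t∈S′ , t∉S)) (p⊆p∪q ⁅ t ⁆ root∈S) σ′ walks′ good′ compat′
      where
      S′ = S ∪ ⁅ t ⁆
      t∈S′ : t ∈ S′
      t∈S′ = q⊆p∪q S ⁅ t ⁆ (x∈⁅x⁆ t)

      split : ∀ {a} → a ∈ S′ → a ∈ S ⊎ a ≡ t
      split a∈ with x∈p∪q⁻ S ⁅ t ⁆ a∈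
      ... | inj₁ a∈S = inj₁ a∈S
      ... | inj₂ a∈t = inj₂ (x∈⁅y⁆⇒x≡y t a∈t)

      σ′ : V T → Y
      σ′ a = if a == t then z else σ a

      σ′-new : σ′ t ≡ z
      σ′-new rewrite ==-refl t = refl

      σ′-old : ∀ {a} → a ∈ S → σ′ a ≡ σ a
      σ′-old {a} a∈S rewrite ==-false a t (λ { refl → t∉S a∈S }) = refl

      old-walk : ∀ {a} → a ∈ S → PWalk T (_∈ S′) root a
      old-walk a∈S = map-walk (p⊆p∪q ⁅ t ⁆) (walks _ a∈S)

      walks′ : ∀ a → a ∈ S′ → PWalk T (_∈ S′) root a
      walks′ a a∈ with split a∈
      ... | inj₁ a∈S  = old-walk a∈S
      ... | inj₂ refl = old-walk s∈S ++ʷ step (p⊆p∪q ⁅ t ⁆ s∈S) st (stop t∈S′)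

      good′ : ∀ a → a ∈ S′ → Good a (σ′ a)
      good′ a a∈ with split a∈
      ... | inj₁ a∈S  = subst (Good a) (sym (σ′-old a∈S)) (good a a∈S)
      ... | inj₂ refl = subst (Good a) (sym σ′-new) good-z

      parent-unique : ∀ {a} → a ∈ S → Adj T a t → a ≡ s
      parent-unique {a} a∈S at with a Fin.≟ s
      ... | yes a≡s = a≡s
      ... | no  a≢s = contradiction
        (close-cycle (reverse (walks a a∈S) ++ʷ walks s s∈S) a≢s t∉S
          (trans (adj-sym T t a) at) (trans (adj-sym T t s) st))
        acyclic

      to-new : ∀ {a} → a ∈ S → Adj T a t → R a t (σ′ a) (σ′ t)
      to-new a∈S at with refl ← parent-unique a∈S at =
        subst₂ (R s t) (sym (σ′-old s∈S)) (sym σ′-new) Rz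

      compat′ : ∀ a b → a ∈ S′ → b ∈ S′ → Adj T a b → R a b (σ′ a) (σ′ b)
      compat′ a b a∈ b∈ ab with split a∈ | split b∈
      ... | inj₁ a∈S  | inj₁ b∈S  = subst₂ (R a b) (sym (σ′-old a∈S)) (sym (σ′-old b∈S)) (compat a b a∈S b∈S ab)
      ... | inj₁ a∈S  | inj₂ refl = to-new a∈S ab
      ... | inj₂ refl | inj₁ b∈S  = R-sym (to-new b∈S (trans (adj-sym T b a) ab))
      ... | inj₂ refl | inj₂ refl = contradiction (trans (sym (adj-irrefl T t)) ab) λ ()

count-lookup : ∀ {n} (p : Subset n) → count (lookup p) ≡ ∣ p ∣
count-lookup []            = refl
count-lookup (true ∷ p)  = cong suc (count-lookup p)
count-lookup (false ∷ p) = count-lookup p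

module _ (F : Graph) where

  open CFI F

  private
    n = size F

  -- A haven lets us carry a defect of the parity equations along the tree: at node t the
  -- equations hold on F except at the robber position, which lies outside the image of the bag.
  solve : ∀ {k} (H : Haven k) F′ → TwAtMost k F′ → ∀ ψ → IsHom F′ F ψ →
          ∃ λ x → Shift.IsShift F′ untwisted (_== Haven.at H untwisted) ψ x
  solve {k} H F′ (D , width) ψ hψ = x , isShift
    where
    open Haven H
    open TreeDecomposition D renaming (connected to bags-connected)
    open Walks tree using (start)

    u : Fin n
    u = at untwisted

    X : V tree → Fin n → Bool
    X t = image ψ (lookup (bag t))

    X-small : ∀ t → count (X t) ≤ suc k
    X-small t = ℕ.≤-trans (count-image-≤ ψ (lookup (bag t)))
      (ℕ.≤-trans (ℕ.≤-reflexive (count-lookup (bag t))) (width t))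

    ∈X : ∀ {a t} → a ∈ bag t → X t (ψ a) ≡ true
    ∈X {a} {t} a∈ = ∈-image ψ (lookup (bag t)) ([]=⇒lookup a∈)

    r : V tree → Fin n
    r t = at (X t)

    Good : V tree → (Fin n → Fin n → Bool) → Set
    Good t y = (∀ v w → y v w ≡ y w v) × (∀ v → degree y v ≡ (v == u) xor (v == r t))

    Agree : V tree → V tree → (Fin n → Fin n → Bool) → (Fin n → Fin n → Bool) → Set
    Agree s t y z = ∀ v → X s v ≡ true → X t v ≡ true → ∀ w → y v w ≡ z v w

    extend : ∀ s t → Adj tree s t → ∀ y → Good s y → ∃ λ z → Good t z × Agree s t y z
    -- The robber's link from `r s` to `r t` is added: it moves the defect and changes nothing at
    -- vertices in both images.
    extend s t _ y (symm , deg) with joined (X s) (X t) (X-small s) (X-small t)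
    ... | i , psymm , pdeg , avoid = (λ v w → y v w xor p v w)
      , ((λ v w → cong₂ _xor_ (symm v w) (psymm v w))
        , λ v → trans (degree-xor y p v)
            (trans (cong₂ _xor_ (deg v) (pdeg v)) (xor-telescope (v == u) (v == r s) (v == r t))))
      , λ v Xs Xt w → sym (trans (cong (y v w xor_) (avoid v w (cong₂ _∧_ Xs Xt))) (xor-identityʳ (y v w)))
      where p = decode₂ n n i

    root : V tree
    root = Fin.fromℕ< (proj₁ isTree)

    untwisted-small : count {n} untwisted ≤ suc k
    untwisted-small = ℕ.≤-trans (ℕ.≤-reflexive (sum-zero n)) z≤n

    section : ∃ λ (σ : V tree → Fin n → Fin n → Bool) →
      (∀ t → Good t (σ t)) × (∀ s t → Adj tree s t → Agree s t (σ s) (σ t))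
    -- Here `untwisted` is the empty set of cops, against which the robber stands at `u`; a link
    -- from there to `r root` is the first local solution.
    section with joined untwisted (X root) untwisted-small (X-small root)
    ... | i , psymm , pdeg , _ =
      tree-section tree (proj₁ (proj₂ isTree)) (proj₂ (proj₂ isTree)) Good Agree
        (λ agree v Xt Xs w → sym (agree v Xs Xt w)) extend root (decode₂ n n i) (psymm , pdeg)

    y : V tree → Fin n → Fin n → Bool
    y = proj₁ section

    home : V F′ → V tree
    home a = proj₁ (vertexCov a)

    x : V F′ → Fin n → Bool
    -- The choice of `home a` does not matter: the nodes whose bags contain `a` are connected, and
    -- solutions at adjacent ones agree at `ψ a`.
    x a = y (home a) (ψ a)

    along : ∀ {a s t} → PWalk tree (λ t → a ∈ bag t) s t → ∀ w → y s (ψ a) w ≡ y t (ψ a) w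
    along (stop _) w = refl
    along {a} (step {s} {t} a∈s st ws) w =
      trans (proj₂ (proj₂ section) s t st (ψ a) (∈X a∈s) (∈X (start ws)) w) (along ws w)

    x-at : ∀ {a t} → a ∈ bag t → ∀ w → x a w ≡ y t (ψ a) w
    x-at {a} {t} a∈ = along (bags-connected a (home a) t (proj₂ (vertexCov a)) a∈)

    isShift : Shift.IsShift F′ untwisted (_== u) ψ x
    isShift a b ab with edgeCov a b ab
    ... | t , a∈ , b∈ = weights , trans (x-at a∈ (ψ b))
        (trans (proj₁ (proj₁ (proj₂ section) t) (ψ a) (ψ b)) (sym (x-at b∈ (ψ a))))
      where
      weights : weight (x a) (ψ a) ≡ ψ a == u
      weights = trans (degree-cong (λ _ → x a) (y t) (ψ a) (x-at a∈))
        (trans (proj₂ (proj₁ (proj₂ section) t) (ψ a))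
          (trans (cong ((ψ a == u) xor_) (==-false (ψ a) (r t) λ eq →
            contradiction (trans (sym (∈X a∈)) (trans (cong (X t) eq) (avoids (X t) (X-small t)))) λ ()))
            (xor-identityʳ (ψ a == u))))

  -- Against a cop on `u` the robber is elsewhere, and a link from `u` to that place has odd degree
  -- at `u`.
  haven-neighbour : ∀ {k} (H : Haven k) → ∃ λ v → Adj F (Haven.at H untwisted) v
  haven-neighbour {k} H with any? (λ v → adj F (Haven.at H untwisted) v ≟ true)
  ... | yes nb = nb
  ... | no isolated = contradiction
    (trans (sym odd) (trans (Parity.sum-cong-≗ zeros) (parity-false n))) λ ()
    where
    open Haven H
    u = at untwisted
    s = at (_== u)
    single-small : count (_== u) ≤ suc k
    single-small = ℕ.≤-trans (ℕ.≤-reflexive (count-singleton u)) (s≤s z≤n)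
    ℓ : Linked (untwisted ∩ (_== u)) u s
    ℓ = joined untwisted (_== u) (ℕ.≤-trans (ℕ.≤-reflexive (sum-zero n)) z≤n) single-small
    p = decode₂ n n (proj₁ ℓ)
    odd : degree p u ≡ true
    odd = trans (proj₁ (proj₂ (proj₂ ℓ)) u) (cong₂ _xor_ (==-refl u)
      (trans (==-sym u s) (avoids (_== u) single-small)))
    zeros : ∀ w → adj F u w ∧ p u w ≡ false
    zeros w with adj F u w in uw
    ... | true  = contradiction (w , uw) isolated
    ... | false = refl

  haven-separates : ∀ {k} → Haven k → Σ Graph λ G → Σ Graph λ H →
    (∀ F′ → TwAtMost k F′ → hom F′ G ≡ hom F′ H) × hom F G ≢ hom F H
  haven-separates β = cfi untwisted , cfi (_== Haven.at β untwisted)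
    , (λ F′ tw → hom-cfi-≡ F′ (_== Haven.at β untwisted) (solve β F′ tw))
    , hom-cfi-≢ _ (proj₂ (haven-neighbour β))

-- Duality

all-or-some : ∀ {c} {A B : Fin c → Set} → (∀ i → A i ⊎ B i) → (∀ i → A i) ⊎ ∃ B
all-or-some {zero}  f = inj₁ λ ()
all-or-some {suc c} f with f zero | all-or-some (f ∘ suc)
... | inj₂ b | _            = inj₂ (zero , b)
... | inj₁ _ | inj₂ (i , b) = inj₂ (suc i , b)
... | inj₁ a | inj₁ as      = inj₁ λ { zero → a ; (suc i) → as i }

x∈p─q⇒x∉q : ∀ {n} {x : Fin n} (p q : Subset n) → x ∈ p ─ q → x ∉ q
x∈p─q⇒x∉q (_ ∷ p) (false ∷ q) (there x∈) (there x∈q) = x∈p─q⇒x∉q p q x∈ x∈q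
x∈p─q⇒x∉q (_ ∷ p) (true  ∷ q) (there x∈) (there x∈q) = x∈p─q⇒x∉q p q x∈ x∈q

clash : ∀ {b} → b ≡ true → ¬ b ≡ false
clash refl ()

_⊑_ : ∀ {m} → (Fin m → Bool) → (Fin m → Bool) → Set
P ⊑ Q = ∀ e → P e ≡ true → Q e ≡ true

Disjoint : ∀ {m} → (Fin m → Bool) → (Fin m → Bool) → Set
Disjoint P Q = ∀ e → P e ≡ true → Q e ≡ false

count-mono-< : ∀ {n} (f g : Fin n → Bool) → f ⊑ g → ∀ x → f x ≡ false → g x ≡ true → count f < count g
count-mono-< f g f⊑g zero fx gx rewrite fx | gx = s≤s (count-mono (f ∘ suc) (g ∘ suc) (f⊑g ∘ suc))
count-mono-< f g f⊑g (suc x) fx gx = ℕ.≤-trans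
  (ℕ.≤-reflexive (sym (ℕ.+-suc _ _)))
  (ℕ.+-mono-≤ (⟦⟧-mono (f zero) (g zero) (f⊑g zero)) (count-mono-< (f ∘ suc) (g ∘ suc) (f⊑g ∘ suc) x fx gx))

module Duality {m n : ℕ} (k : ℕ) (inc : Fin m → Fin n → Bool) where

  EdgeSet : Set
  EdgeSet = Fin m → Bool

  full : EdgeSet
  full _ = true

  -- A partition of the ground set: colour zero is the complement of Q, the other colours
  -- partition Q, and the bag contains every vertex at which two colours meet.
  record Split (Q : EdgeSet) : Set where
    field
      {parts} : ℕ
      colour  : Fin m → Fin (suc parts)
      bag     : Fin n → Bool
      small   : count bag ≤ suc k
      outside : ∀ e → Q e ≡ not (colour e == zero)
      border  : ∀ v e e′ → inc e v ≡ true → inc e′ v ≡ true → bag v ≡ false → colour e ≡ colour e′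

    part : Fin parts → EdgeSet
    part i e = colour e == suc i

  -- Partial tree decompositions of Q whose unfinished leaves are sets in N.
  data Decomposes (N : EdgeSet → Set) : EdgeSet → Set where
    leaf : ∀ {Q} → N Q → Decomposes N Q
    node : ∀ {Q} (s : Split Q) → (∀ i → Decomposes N (Split.part s i)) → Decomposes N Q

  decomposes-map : ∀ {N N′ Q} → (∀ {P} → N P → N′ P) → Decomposes N Q → Decomposes N′ Q
  decomposes-map f (leaf NQ)  = leaf (f NQ)
  decomposes-map f (node s d) = node s λ i → decomposes-map f (d i)

  DownClosed : (EdgeSet → Set) → Set
  DownClosed N = ∀ P Q → P ⊑ Q → N Q → N P

  -- At a leaf, down-closure also yields invariance under pointwise equality.
  decomposes-cong : ∀ {N P Q} → DownClosed N → P ≗ Q → Decomposes N P → Decomposes N Q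
  decomposes-cong {P = P} {Q} down P≗Q (leaf NP) = leaf (down Q P (λ e → trans (P≗Q e)) NP)
  decomposes-cong down P≗Q (node s d) = node record
    { colour = colour ; bag = bag ; small = small
    ; outside = λ e → trans (sym (P≗Q e)) (outside e) ; border = border } d
    where open Split s

  boundary? : (Z : EdgeSet) (v : Fin n) →
    Dec (∃ (λ e → inc e v ≡ true × Z e ≡ true) × ∃ (λ e → inc e v ≡ true × Z e ≡ false))
  boundary? Z v = any? (λ e → (inc e v ≟ true) ×-dec (Z e ≟ true))
            ×-dec any? (λ e → (inc e v ≟ true) ×-dec (Z e ≟ false))

  boundary : EdgeSet → Fin n → Bool
  boundary Z v = does (boundary? Z v)

  boundary⁻ : ∀ Z {v} → boundary Z v ≡ true →
              ∃ (λ e → inc e v ≡ true × Z e ≡ true) × ∃ (λ e → inc e v ≡ true × Z e ≡ false)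
  boundary⁻ Z {v} = does-true (boundary? Z v)

  boundary⁺ : ∀ Z {v e e′} → inc e v ≡ true → Z e ≡ true → inc e′ v ≡ true → Z e′ ≡ false →
              boundary Z v ≡ true
  boundary⁺ Z {v} {e} {e′} ev Ze e′v Ze′ = dec-true (boundary? Z v) ((e , ev , Ze) , (e′ , e′v , Ze′))

  boundary-false : ∀ Z {v e e′} → boundary Z v ≡ false → inc e v ≡ true → inc e′ v ≡ true → Z e ≡ Z e′
  boundary-false Z {v} {e} {e′} b ev e′v with Z e in Ze | Z e′ in Ze′
  ... | true  | true  = refl
  ... | false | false = refl
  ... | true  | false = contradiction (trans (sym b) (boundary⁺ Z ev Ze e′v Ze′)) λ ()
  ... | false | true  = contradiction (trans (sym b) (boundary⁺ Z e′v Ze′ ev Ze)) λ ()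

  boundary-complement : ∀ Z Z′ → (∀ e → Z′ e ≡ not (Z e)) → count (boundary Z) ≤ count (boundary Z′)
  boundary-complement Z Z′ eq = count-mono (boundary Z) (boundary Z′) λ v b →
    let (e , ev , Ze) , (e′ , e′v , Ze′) = boundary⁻ Z b
    in boundary⁺ Z′ e′v (trans (eq e′) (cong not Ze′)) ev (trans (eq e) (cong not Ze))

  LeastBoundary : (A Z : EdgeSet) → Set
  LeastBoundary A Z = ∀ D → A ⊑ D → D ⊑ Z → count (boundary Z) ≤ count (boundary D)

  private
    -- For one vertex: `x`, `z`, `d` say whether it is in the old bag, the boundary of `Z` and the
    -- boundary of `D` in `restrict`; the first summand is its membership in the new bag.
    submodular : ∀ x z d → (d ≡ true → x ∨ z ≡ true) →
                 ⟦ (x ∧ z) ∨ ((x ∨ z) ∧ not d) ⟧ + ⟦ d ⟧ ≤ ⟦ x ⟧ + ⟦ z ⟧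
    submodular true  true  true  _ = ℕ.≤-refl
    submodular true  true  false _ = s≤s z≤n
    submodular true  false true  _ = ℕ.≤-refl
    submodular true  false false _ = ℕ.≤-refl
    submodular false true  true  _ = ℕ.≤-refl
    submodular false true  false _ = ℕ.≤-refl
    submodular false false false _ = z≤n
    submodular false false true  h = contradiction (h refl) λ ()

  -- Removing Z from all parts except the one containing A does not enlarge the bags: otherwise
  -- submodularity would make the intersection of Z with that part a better choice than Z.
  restrict : ∀ {N A Z} → DownClosed N → A ⊑ Z → LeastBoundary A Z →
             ∀ {Q} → Disjoint A Q → ∀ {Q′} → (∀ e → Q′ e ≡ Q e ∧ not (Z e)) →
             Decomposes N Q → Decomposes N Q′
  restrict {Z = Z} down A⊑Z least {Q} A∩Q {Q′} eq (leaf NQ) =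
    leaf (down Q′ Q (λ e Q′e → ∧-left (trans (sym (eq e)) Q′e)) NQ)
    where
    ∧-left : ∀ {a b} → a ∧ b ≡ true → a ≡ true
    ∧-left {true} _ = refl
  restrict {A = A} {Z} down A⊑Z least {Q} A∩Q {Q′} eq (node s d) = node
    record { colour = colour′ ; bag = bag′ ; small = small′ ; outside = outside′ ; border = border′ }
    λ i → restrict down A⊑Z least (λ e Ae → A∩part i e Ae) (part′ i) (d i)
    where
    open Split s

    colour′ : Fin m → Fin (suc parts)
    colour′ e = if Z e then zero else colour e

    A-zero : ∀ e → A e ≡ true → colour e == zero ≡ true
    A-zero e Ae = trans (sym (not-involutive _)) (cong not (trans (sym (outside e)) (A∩Q e Ae)))

    A∩part : ∀ i → Disjoint A (part i)
    A∩part i e Ae = cong (_== suc i) (==-true (colour e) zero (A-zero e Ae))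

    part′ : ∀ i e → colour′ e == suc i ≡ part i e ∧ not (Z e)
    part′ i e with Z e
    ... | true  = sym (∧-zeroʳ (part i e))
    ... | false = sym (∧-identityʳ (part i e))

    outside′ : ∀ e → Q′ e ≡ not (colour′ e == zero)
    outside′ e rewrite eq e | outside e with Z e
    ... | true  = ∧-zeroʳ _
    ... | false = ∧-identityʳ _

    -- The competitor to `Z`: it contains `A`, which misses `Q` and hence has colour `zero`.
    D : EdgeSet
    D e = Z e ∧ (colour e == zero)

    -- A vertex in only one of `bag` and the boundary of `Z` is dropped if it is on the boundary of
    -- `D`; all its edges then receive colour `zero`.
    bag′ : Fin n → Bool
    bag′ v = (bag v ∧ boundary Z v) ∨ ((bag v ∨ boundary Z v) ∧ not (boundary D v))

    D-covered : ∀ v → boundary D v ≡ true → bag v ∨ boundary Z v ≡ true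
    D-covered v b with boundary⁻ D b | bag v in bv
    ... | _ | true = refl
    ... | (e , ev , De) , (e′ , e′v , De′) | false with Z e in Ze | Z e′ in Ze′
    ... | true | false = boundary⁺ Z ev Ze e′v Ze′
    ... | true | true  = contradiction
      (trans (sym De′) (trans (cong (_== zero) (border v e′ e e′v ev bv)) De)) λ ()

    small′ : count bag′ ≤ suc k
    small′ = ℕ.≤-trans (ℕ.+-cancelʳ-≤ (count (boundary D)) _ _ (begin
      count bag′ + count (boundary D)
        ≡⟨ Total.∑-distrib-+ (⟦_⟧ ∘ bag′) (⟦_⟧ ∘ boundary D) ⟨
      Total.sum (λ v → ⟦ bag′ v ⟧ + ⟦ boundary D v ⟧)
        ≤⟨ sum-mono-≤ (λ v → submodular (bag v) (boundary Z v) (boundary D v) (D-covered v)) ⟩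
      Total.sum (λ v → ⟦ bag v ⟧ + ⟦ boundary Z v ⟧)
        ≡⟨ Total.∑-distrib-+ (⟦_⟧ ∘ bag) (⟦_⟧ ∘ boundary Z) ⟩
      count bag + count (boundary Z)
        ≤⟨ ℕ.+-monoʳ-≤ (count bag) (least D A⊑D D⊑Z) ⟩
      count bag + count (boundary D) ∎)) small
      where
      open ℕ.≤-Reasoning
      A⊑D : A ⊑ D
      A⊑D e Ae = cong₂ _∧_ (A⊑Z e Ae) (A-zero e Ae)
      D⊑Z : D ⊑ Z
      D⊑Z e De with Z e
      ... | true = refl

    border′ : ∀ v e e′ → inc e v ≡ true → inc e′ v ≡ true → bag′ v ≡ false → colour′ e ≡ colour′ e′
    border′ v e e′ ev e′v b with bag v in bv | boundary Z v in zv | boundary D v in dv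
    border′ v e e′ ev e′v () | true  | true  | _
    border′ v e e′ ev e′v () | true  | false | false
    border′ v e e′ ev e′v () | false | true  | false
    ... | false | false | _ = cong₂ (λ b c → if b then zero else c)
      (boundary-false Z zv ev e′v) (border v e e′ ev e′v bv)
    ... | false | true | true = trans (zeroed e ev) (sym (zeroed e′ e′v))
      where
      zeroed : ∀ e → inc e v ≡ true → colour′ e ≡ zero
      zeroed e ev with boundary⁻ D dv
      ... | (e₀ , e₀v , De₀) , _ with Z e | Z e₀
      ... | true  | _    = refl
      ... | false | true = trans (border v e e₀ ev e₀v bv) (==-true (colour e₀) zero De₀)
    ... | true | false | true = trans (zeroed e ev) (sym (zeroed e′ e′v))
      where
      zeroed : ∀ e → inc e v ≡ true → colour′ e ≡ zero
      zeroed e ev with boundary⁻ D dv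
      ... | (e₀ , e₀v , De₀) , _ rewrite boundary-false Z {e = e} zv ev e₀v with Z e₀
      ... | true = refl

  -- The part above the leaf P becomes, seen from P, a decomposition of the complement of P. At most
  -- one part of each split contains e₀, so no other leaf of the tree is a copy of P.
  reroot : ∀ {N P e₀} → DownClosed N → P e₀ ≡ true →
           ∀ {Q} → Decomposes (λ R → N R ⊎ R ≗ P) Q →
           Decomposes N Q ⊎ (Q e₀ ≡ true × (Decomposes N (not ∘ Q) → Decomposes N (not ∘ P)))
  reroot down Pe₀ (leaf (inj₁ NQ))  = inj₁ (leaf NQ)
  reroot down Pe₀ (leaf (inj₂ Q≗P)) = inj₂ (trans (Q≗P _) Pe₀ , decomposes-cong down (cong not ∘ Q≗P))
  reroot {N} {P} {e₀} down Pe₀ {Q} (node s d) with all-or-some (λ i → reroot down Pe₀ (d i))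
  ... | inj₁ ds = inj₁ (node s ds)
  ... | inj₂ (i , e₀∈i , up) = inj₂ (e₀∈Q , λ above → up (node swapped (rest above)))
    where
    open Split s

    e₀∈Q : Q e₀ ≡ true
    e₀∈Q = trans (outside e₀) (cong (λ c → not (c == zero)) (==-true (colour e₀) (suc i) e₀∈i))

    -- Exchanging the colours `zero` and `suc i` makes the outside of `Q` a part and part `i` the
    -- new outside.
    swap : Fin (suc parts) → Fin (suc parts)
    swap c = if c == zero then suc i else (if c == suc i then zero else c)

    swap-zero : ∀ c → swap c == zero ≡ c == suc i
    swap-zero zero = refl
    swap-zero (suc c) with c Fin.≟ i
    ... | yes refl = refl
    ... | no _     = refl

    swap-i : ∀ c → swap c == suc i ≡ c == zero
    swap-i zero = ==-refl i
    swap-i (suc c) with c Fin.≟ i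
    ... | yes refl = refl
    ... | no c≢i   = ==-false c i c≢i

    swap-other : ∀ {j} → j ≢ i → ∀ c → swap c == suc j ≡ c == suc j
    swap-other {j} j≢i zero = ==-false i j (j≢i ∘ sym)
    swap-other {j} j≢i (suc c) with c Fin.≟ i
    ... | yes refl = sym (==-false i j (j≢i ∘ sym))
    ... | no _     = refl

    swapped : Split (not ∘ part i)
    swapped = record
      { colour = swap ∘ colour ; bag = bag ; small = small
      ; outside = λ e → cong not (sym (swap-zero (colour e)))
      ; border = λ v e e′ ev e′v b → cong swap (border v e e′ ev e′v b) }

    rest : Decomposes N (not ∘ Q) → ∀ j → Decomposes N (Split.part swapped j)
    rest above j with j Fin.≟ i
    ... | yes refl = decomposes-cong down
      (λ e → trans (trans (cong not (outside e)) (not-involutive _)) (sym (swap-i (colour e)))) above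
    ... | no j≢i with reroot down Pe₀ (d j)
    ... | inj₁ dj = decomposes-cong down (λ e → sym (swap-other j≢i (colour e))) dj
    ... | inj₂ (e₀∈j , _) =
      contradiction (suc-injective (trans (sym (==-true (colour e₀) (suc j) e₀∈j)) (==-true (colour e₀) (suc i) e₀∈i))) j≢i

  -- Large and small edge sets

  Large : Subset (2 ^ m) → EdgeSet → Set
  Large M Q = encode Q ∈ M

  Small : Subset (2 ^ m) → EdgeSet → Set
  Small M Q = encode Q ∉ M

  support : EdgeSet → Fin n → Bool
  support Q v = does (any? λ e → (inc e v ≟ true) ×-dec (Q e ≟ true))

  support⁺ : ∀ Q {v e} → inc e v ≡ true → Q e ≡ true → support Q v ≡ true
  support⁺ Q {v} {e} ev Qe = dec-true (any? _) (e , ev , Qe)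

  support⁻ : ∀ Q {v} → support Q v ≡ true → ∃ λ e → inc e v ≡ true × Q e ≡ true
  support⁻ Q = does-true (any? _)

  support-mono : ∀ {P Q} → P ⊑ Q → support P ⊑ support Q
  support-mono {P} {Q} P⊑Q v sv = let e , ev , Pe = support⁻ P sv in support⁺ Q ev (P⊑Q e Pe)

  FitsInBag : EdgeSet → Set
  FitsInBag Q = count (support Q) ≤ suc k

  empty-fits : ∀ Q → (∀ e → Q e ≡ false) → FitsInBag Q
  empty-fits Q empty = ℕ.≤-trans (count-mono (support Q) (λ _ → false) λ v sv →
      let e , _ , Qe = support⁻ Q sv in trans (sym (empty e)) Qe)
    (ℕ.≤-trans (ℕ.≤-reflexive (sum-zero n)) z≤n)

  -- The invariant kept while further sets are declared small by removing their codes from `M`.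
  record Consistent (M : Subset (2 ^ m)) : Set where
    field
      down         : DownClosed (Small M)
      fits         : ∀ Q → FitsInBag Q → Small M Q
      indecomposed : ¬ Decomposes (Small M) full

  Minimal : Subset (2 ^ m) → EdgeSet → Set
  Minimal M P = Large M P × (∀ Q e → Q ⊑ P → P e ≡ true → Q e ≡ false → Small M Q)

  -- Minimal large sets cannot be declared small any more without a decomposition appearing.
  Saturated : Subset (2 ^ m) → Set
  Saturated M = ∀ P → Minimal M P → ¬ ¬ Decomposes (Small M) (not ∘ P)

  large-nonempty : ∀ {M} → Consistent M → ∀ {P} → Large M P → ∃ λ e → P e ≡ true
  large-nonempty con {P} large = decidable-stable (any? λ e → P e ≟ true) λ empty →
    Consistent.fits con P (empty-fits P λ e → ¬-not λ Pe → empty (e , Pe)) large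

  -- Down-closure survives because `P` is minimal. A new decomposition of `full` would have `P` as a
  -- leaf and, rerooted there, decompose the complement of `P`.
  consistent-remove : ∀ {M P} → Consistent M → Minimal M P → ¬ Decomposes (Small M) (not ∘ P) →
                      Consistent (M - encode P)
  consistent-remove {M} {P} con (large , minimal) ¬dec = record
    { down = down′
    ; fits = λ Q fit → fits Q fit ∘ p─q⊆p M _
    ; indecomposed = λ dec → absurd (reroot down (proj₂ (large-nonempty con large)) (decomposes-map old-or-P dec))
    }
    where
    open Consistent con

    old-or-P : ∀ {Q} → Small (M - encode P) Q → Small M Q ⊎ Q ≗ P
    old-or-P {Q} small with encode Q Fin.≟ encode P
    ... | no ≢P = inj₁ λ Q∈M → small (x∈p∧x≢y⇒x∈p-y Q∈M ≢P)
    ... | yes ≡P = inj₂ λ e → trans (sym (decode-encode Q e))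
      (trans (cong (λ c → decode m c e) ≡P) (decode-encode P e))

    down′ : DownClosed (Small (M - encode P))
    down′ Q Q′ Q⊑Q′ small Q∈ with old-or-P small
    ... | inj₁ smallQ′ = down Q Q′ Q⊑Q′ smallQ′ (p─q⊆p M _ Q∈)
    ... | inj₂ Q′≗P with all? (λ e → Q e ≟ P e)
    ... | yes Q≗P = x∈p─q⇒x∉q M _ (subst (_∈ M - encode P) (encode-cong Q≗P) Q∈) (x∈⁅x⁆ _)
    ... | no Q≢P with e , Qe≢Pe ← ¬∀⟶∃¬ _ _ (λ e → Q e ≟ P e) Q≢P =
      minimal Q e Q⊑P (proj₁ (differ e Qe≢Pe)) (proj₂ (differ e Qe≢Pe)) (p─q⊆p M _ Q∈)
      where
      Q⊑P : Q ⊑ P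
      Q⊑P e Qe = trans (sym (Q′≗P e)) (Q⊑Q′ e Qe)
      differ : ∀ e → Q e ≢ P e → P e ≡ true × Q e ≡ false
      differ e ≢ with Q e in Qe | P e in Pe
      ... | true  | true  = contradiction refl ≢
      ... | false | false = contradiction refl ≢
      ... | false | true  = refl , refl
      ... | true  | false = contradiction (trans (sym Pe) (Q⊑P e Qe)) λ ()

    absurd : ¬ (Decomposes (Small M) full
                ⊎ (true ≡ true × (Decomposes (Small M) (not ∘ full) → Decomposes (Small M) (not ∘ P))))
    absurd (inj₁ dec)      = indecomposed dec
    -- Above the root of a decomposition of `full` lies the empty set, which fits in a bag.
    absurd (inj₂ (_ , up)) = ¬dec (up (leaf (fits (not ∘ full) (empty-fits (not ∘ full) λ _ → refl))))

  -- While saturation fails, a minimal large set can be removed, and `M` shrinks. The double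
  -- negation replaces a case distinction on decomposability.
  saturate : ∀ M → Acc _⊂_ M → Consistent M → ¬ ¬ ∃ λ M → Consistent M × Saturated M
  saturate M (acc rec) con none = none (M , con , λ P min@(large , _) ¬dec →
    saturate (M - encode P) (rec (x∈p⇒p-x⊂p large)) (consistent-remove con min ¬dec) none)

  initial : ¬ Decomposes FitsInBag full → ∃ Consistent
  initial ¬dec = M , record
    { down = λ P Q P⊑Q small → fits P (ℕ.≤-trans
        (count-mono (support P) (support Q) (support-mono P⊑Q)) (fits⁻ Q small))
    ; fits = fits
    ; indecomposed = ¬dec ∘ decomposes-map (λ {Q} → fits⁻ Q) }
    where
    fits? : ∀ Q → Dec (FitsInBag Q)
    fits? Q = count (support Q) ≤? suc k

    M : Subset (2 ^ m)
    M = tabulate λ c → not (does (fits? (decode m c)))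

    fits-cong : ∀ {P Q} → P ≗ Q → FitsInBag P → FitsInBag Q
    fits-cong {P} {Q} P≗Q = ℕ.≤-trans
      (count-mono (support Q) (support P) (support-mono {Q} {P} λ e → trans (P≗Q e)))

    fits : ∀ Q → FitsInBag Q → Small M Q
    fits Q fit Q∈M = contradiction
      (trans (sym ([]=⇒lookup Q∈M)) (trans (lookup∘tabulate _ (encode Q))
        (cong not (dec-true (fits? _) (fits-cong (λ e → sym (decode-encode Q e)) fit)))))
      λ ()

    fits⁻ : ∀ Q → Small M Q → FitsInBag Q
    fits⁻ Q small = decidable-stable (fits? Q) λ ¬fit → small (lookup⇒[]= _ M
      (trans (lookup∘tabulate _ (encode Q))
        (cong not (dec-false (fits? _) (¬fit ∘ fits-cong (decode-encode Q))))))

  module _ {M : Subset (2 ^ m)} (con : Consistent M) (sat : Saturated M) where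

    open Consistent con

    minimal-below : ∀ A → Acc _<_ (count A) → Large M A → ¬ ¬ ∃ λ P → Minimal M P × P ⊑ A
    minimal-below A (acc rec) large none = none (A , (large , λ Q e Q⊑A Ae Qe Q∈M →
      minimal-below Q (rec (count-mono-< Q A Q⊑A e Qe Ae)) Q∈M λ (P , min , P⊑Q) →
        none (P , min , λ e Pe → Q⊑A e (P⊑Q e Pe))) , λ _ Ae → Ae)

    least-separator : ∀ A B Z → Acc _<_ (count (boundary Z)) → A ⊑ Z → Disjoint Z B →
      ¬ ¬ ∃ λ Z → A ⊑ Z × Disjoint Z B ×
        (∀ D → A ⊑ D → Disjoint D B → count (boundary Z) ≤ count (boundary D))
    least-separator A B Z (acc rec) A⊑Z Z∩B none = none (Z , A⊑Z , Z∩B , λ D A⊑D D∩B →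
      decidable-stable (_ ≤? _) λ ≰ → least-separator A B D (rec (ℕ.≰⇒> ≰)) A⊑D D∩B none)

    -- Containing a large set, `Z` is no leaf. Its first split gains `Z′`, the outside, as an
    -- additional part and becomes a split of `full`.
    no-complementary : ∀ {A Z Z′} → Large M A → A ⊑ Z → (∀ e → Z′ e ≡ not (Z e)) →
                       Decomposes (Small M) Z → ¬ Decomposes (Small M) Z′
    no-complementary {A} {Z} large A⊑Z _ (leaf small) _ = down A Z A⊑Z small large
    no-complementary large A⊑Z eq (node s d) d′ = indecomposed (node
      record { colour = suc ∘ colour ; bag = bag ; small = small ; outside = λ _ → refl
             ; border = λ v e e′ ev e′v b → cong suc (border v e e′ ev e′v b) }
      λ { zero → decomposes-cong down
            (λ e → trans (eq e) (trans (cong not (outside e)) (not-involutive _))) d′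
        ; (suc i) → d i })
      where open Split s

    -- Disjoint `A` and `B` contain minimal large sets `A′` and `B′`, whose complements decompose by
    -- saturation. For `Z` of least boundary between them, the decomposition from `B′` restricts to
    -- `Z` and the one from `A′` to its complement.
    large-sets-meet : ∀ A B → Large M A → Large M B → ∃ λ e → A e ≡ true × B e ≡ true
    large-sets-meet A B largeA largeB =
      decidable-stable (any? λ e → (A e ≟ true) ×-dec (B e ≟ true)) λ disjoint →
      minimal-below A (<-wellFounded _) largeA λ (A′ , minA , A′⊑A) →
      minimal-below B (<-wellFounded _) largeB λ (B′ , minB , B′⊑B) →
      sat A′ minA λ decA →
      sat B′ minB λ decB →
      least-separator A′ B′ A′ (<-wellFounded _) (λ _ A′e → A′e)
        (λ e A′e → ¬-not λ B′e → disjoint (e , A′⊑A e A′e , B′⊑B e B′e))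
      λ (Z , A′⊑Z , Z∩B′ , least) →
      let B′⊑Zᶜ : B′ ⊑ (not ∘ Z)
          B′⊑Zᶜ = λ e B′e → cong not (¬-not λ Ze → clash B′e (Z∩B′ e Ze))
          leastᶜ : LeastBoundary B′ (not ∘ Z)
          -- A set and its complement have the same boundary, so minimality carries over to the
          -- other side.
          leastᶜ = λ D B′⊑D D⊑Zᶜ → ℕ.≤-trans
            (boundary-complement (not ∘ Z) Z (λ e → sym (not-involutive (Z e))))
            (ℕ.≤-trans
              (least (not ∘ D) (λ e A′e → cong not (¬-not λ De → clash (D⊑Zᶜ e De) (cong not (A′⊑Z e A′e))))
                 (λ e Dᶜe → ¬-not λ B′e → clash Dᶜe (cong not (B′⊑D e B′e))))
              (boundary-complement (not ∘ D) D (λ e → sym (not-involutive (D e)))))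
      in no-complementary {Z = Z} {Z′ = not ∘ Z} (proj₁ minA) A′⊑Z (λ _ → refl)
           (restrict {Z = not ∘ Z} down B′⊑Zᶜ leastᶜ (λ e B′e → cong not B′e)
             (λ e → sym (trans (cong (not (B′ e) ∧_) (not-involutive (Z e))) (absorb B′ Z e Z∩B′))) decB)
           (restrict {Z = Z} down A′⊑Z (λ D A′⊑D D⊑Z → least D A′⊑D (λ e De → Z∩B′ e (D⊑Z e De)))
             (λ e A′e → cong not A′e)
             (λ e → sym (absorb A′ (not ∘ Z) e λ e Zᶜe → ¬-not λ A′e → clash Zᶜe (cong not (A′⊑Z e A′e)))) decA)
      where
      absorb : ∀ (A Z : EdgeSet) e → Disjoint Z A → not (A e) ∧ Z e ≡ Z e
      absorb A Z e Z∩A with Z e in Ze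
      ... | true  rewrite Z∩A e Ze = refl
      ... | false = ∧-zeroʳ _

-- Assembling a tree decomposition

-- These are the cyclic predecessor and successor; hence a vertex with a single neighbour lies on no
-- cycle.
cycle-neighbours : ∀ G ((l , c , _) : HasCycle G) i →
                   ∃₂ λ j j′ → j ≢ j′ × Adj G (c i) (c j) × Adj G (c i) (c j′)
cycle-neighbours G (l , c , _ , steps , closing) i with view i
... | ‵inject₁ zero = suc zero , fromℕ _ , (λ ()) , steps zero , trans (adj-sym G _ _) closing
... | ‵inject₁ (suc j) = inject₁ (inject₁ j) , suc (suc j)
  , (λ eq → ℕ.<⇒≢ (ℕ.m<n⇒m<1+n (ℕ.n<1+n (toℕ j)))
      (trans (sym (trans (toℕ-inject₁ (inject₁ j)) (toℕ-inject₁ j))) (cong toℕ eq)))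
  , trans (adj-sym G _ _) (steps (inject₁ j)) , steps (suc j)
... | ‵fromℕ = inject₁ (fromℕ _) , zero , (λ ()) , trans (adj-sym G _ _) (steps (fromℕ _)) , closing

-- Adding a leaf to a tree

module _ (T : Graph) (p : V T) where

  private
    leafAdj : Fin (suc (size T)) → Fin (suc (size T)) → Bool
    leafAdj zero    zero    = false
    leafAdj zero    (suc t) = t == p
    leafAdj (suc s) zero    = s == p
    leafAdj (suc s) (suc t) = adj T s t

    leafAdj-sym : ∀ s t → leafAdj s t ≡ leafAdj t s
    leafAdj-sym zero    zero    = refl
    leafAdj-sym zero    (suc t) = refl
    leafAdj-sym (suc s) zero    = refl
    leafAdj-sym (suc s) (suc t) = adj-sym T s t

    leafAdj-irrefl : ∀ s → leafAdj s s ≡ false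
    leafAdj-irrefl zero    = refl
    leafAdj-irrefl (suc s) = adj-irrefl T s

  addLeaf : Graph
  addLeaf = record { size = suc (size T) ; adj = leafAdj ; sym = leafAdj-sym ; irrefl = leafAdj-irrefl }

  lift-walk : ∀ {P Q x y} → (∀ {v} → P v → Q (suc v)) → PWalk T P x y → PWalk addLeaf Q (suc x) (suc y)
  lift-walk f (stop Px)     = stop (f Px)
  lift-walk f (step Px a w) = step (f Px) a (lift-walk f w)

  -- Serves both for connectedness of the tree, with `P` trivial, and for coherence of bags, with
  -- `P` the nodes whose bags contain a given vertex.
  leaf-connected : ∀ {P} → (∀ s t → P (suc s) → P (suc t) → PWalk T (P ∘ suc) s t) →
                   (∀ t → P zero → P (suc t) → P (suc p)) →
                   ∀ s t → P s → P t → PWalk addLeaf P s t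
  leaf-connected old new zero    zero    Ps Pt = stop Ps
  leaf-connected old new (suc s) (suc t) Ps Pt = lift-walk (λ z → z) (old s t Ps Pt)
  leaf-connected old new zero    (suc t) Ps Pt = let Pp = new t Ps Pt in
    step Ps (==-refl p) (lift-walk (λ z → z) (old p t Pp Pt))
  leaf-connected old new (suc s) zero    Ps Pt = let Pp = new s Pt Ps in
    Walks._++ʷ_ addLeaf (lift-walk (λ z → z) (old s p Ps Pp)) (step Pp (==-refl p) (stop Pt))

  leaf-acyclic : ¬ HasCycle T → ¬ HasCycle addLeaf
  leaf-acyclic acyclic cyc@(l , c , inj , steps , closing) with any? (λ i → c i Fin.≟ zero)
  ... | yes (i , ci) = let j , j′ , j≢j′ , a , a′ = cycle-neighbours addLeaf cyc i in
    j≢j′ (inj (trans (only (c j) (subst (λ v → Adj addLeaf v (c j)) ci a))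
                (sym (only (c j′) (subst (λ v → Adj addLeaf v (c j′)) ci a′)))))
    where
    only : ∀ v → Adj addLeaf zero v → v ≡ suc p
    only (suc t) a = cong suc (==-true t p a)
  ... | no avoids = acyclic (l , d
      , (λ {i} {j} eq → inj (trans (c≡ i) (trans (cong suc eq) (sym (c≡ j)))))
      , (λ i → subst₂ (Adj addLeaf) (c≡ (inject₁ i)) (c≡ (suc i)) (steps i))
      , subst₂ (Adj addLeaf) (c≡ (fromℕ _)) (c≡ zero) closing)
    where
    pre : ∀ v → v ≢ zero → ∃ λ t → v ≡ suc t
    pre zero    v≢0 = contradiction refl v≢0
    pre (suc t) _   = t , refl
    d : Fin (suc (suc (suc l))) → V T
    d i = proj₁ (pre (c i) λ ci → avoids (i , ci))
    c≡ : ∀ i → c i ≡ suc (d i)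
    c≡ i = proj₂ (pre (c i) λ ci → avoids (i , ci))

  leaf-isTree : IsTree T → IsTree addLeaf
  leaf-isTree (_ , connected , acyclic) = s≤s z≤n
    , (λ s t → leaf-connected (λ s t _ _ → connected s t) (λ _ _ _ → tt) s t tt tt)
    , leaf-acyclic acyclic

singleton : Graph
singleton = record { size = 1 ; adj = λ _ _ → false ; sym = λ _ _ → refl ; irrefl = λ _ → refl }

singleton-isTree : IsTree singleton
singleton-isTree = s≤s z≤n , (λ { zero zero → stop tt }) , λ (_ , _ , _ , _ , closing) → contradiction closing λ ()

module Assembly {m n : ℕ} (k : ℕ) (inc : Fin m → Fin n → Bool) where

  open Duality k inc

  -- A tree decomposition under construction, before the covering conditions are met.
  record BagTree : Set where
    field
      tree     : Graph
      isTree   : IsTree tree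
      bag      : V tree → Fin n → Bool
      small    : ∀ t → count (bag t) ≤ suc k
      coherent : ∀ v s t → bag s v ≡ true → bag t v ≡ true → PWalk tree (λ t → bag t v ≡ true) s t

    Occurs : Fin n → Set
    Occurs v = ∃ λ t → bag t v ≡ true

  open BagTree

  graft : (S : BagTree) (p : V (tree S)) (B : Fin n → Bool) → count B ≤ suc k →
          (∀ v → B v ≡ true → Occurs S v → bag S p v ≡ true) → BagTree
  graft S p B B-small overlaps = record
    { tree     = addLeaf (tree S) p
    ; isTree   = leaf-isTree (tree S) p (isTree S)
    ; bag      = B VF.∷ bag S
    ; small    = λ { zero → B-small ; (suc t) → small S t }
    ; coherent = λ v → leaf-connected (tree S) p (coherent S v) λ t Bv bv → overlaps v Bv (t , bv)
    }

  record Extends (S S′ : BagTree) : Set where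
    field
      embed     : V (tree S) → V (tree S′)
      bag-embed : ∀ t → bag S′ (embed t) ≗ bag S t

  open Extends

  extends-trans : ∀ {S S′ S″} → Extends S S′ → Extends S′ S″ → Extends S S″
  extends-trans x y = record
    { embed = embed y ∘ embed x ; bag-embed = λ t v → trans (bag-embed y (embed x t) v) (bag-embed x t v) }

  graft-extends : ∀ {S p B s o} → Extends S (graft S p B s o)
  graft-extends = record { embed = suc ; bag-embed = λ _ _ → refl }

  Covers : BagTree → Fin m → Set
  Covers S e = ∃ λ t → ∀ v → inc e v ≡ true → bag S t v ≡ true

  covers-extends : ∀ {S S′} → Extends S S′ → ∀ {e} → Covers S e → Covers S′ e
  covers-extends x (t , cov) = embed x t , λ v ev → trans (bag-embed x t v) (cov v ev)

  record Attached (S : BagTree) (Covered : Fin m → Set) (New : Fin n → Set) : Set where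
    field
      result   : BagTree
      extends  : Extends S result
      covers   : ∀ e → Covered e → Covers result e
      confined : ∀ v → Occurs result v → Occurs S v ⊎ New v

  open Attached

  -- A vertex that `Q` shares with the tree so far must also lie on an edge outside `Q`. Two colours
  -- of any split of `Q` then meet at it, so it belongs to the trimmed bag.
  Attachable : EdgeSet → Set
  Attachable Q = ∀ (S : BagTree) (p : V (tree S)) →
    (∀ v → support Q v ≡ true → Occurs S v → bag S p v ≡ true × support (not ∘ Q) v ≡ true) →
    Attached S (λ e → Q e ≡ true) (λ v → support Q v ≡ true)

  -- All parts hang from one node `q`, whose bag contains what they share with each other and with
  -- `S`. Attaching one part adds only occurrences of its own vertices, so the condition persists
  -- for the rest.
  attach-all : ∀ {c} (Ps : Fin c → EdgeSet) (B : Fin n → Bool) → (∀ i → Attachable (Ps i)) →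
    (∀ i j v → i ≢ j → support (Ps i) v ≡ true → support (Ps j) v ≡ true →
       B v ≡ true × support (not ∘ Ps i) v ≡ true) →
    (S : BagTree) (q : V (tree S)) → bag S q ≗ B →
    (∀ i v → support (Ps i) v ≡ true → Occurs S v → B v ≡ true × support (not ∘ Ps i) v ≡ true) →
    Attached S (λ e → ∃ λ i → Ps i e ≡ true) (λ v → ∃ λ i → support (Ps i) v ≡ true)
  attach-all {zero} Ps B attach meet S q qB inv = record
    { result = S ; extends = record { embed = λ t → t ; bag-embed = λ _ _ → refl }
    ; covers = λ _ () ; confined = λ _ → inj₁ }
  attach-all {suc c} Ps B attach meet S q qB inv = record
    { result   = result rest
    ; extends  = extends-trans (extends first) (extends rest)
    ; covers   = λ { e (zero , Pe) → covers-extends (extends rest) (covers first e Pe)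
                   ; e (suc i , Pe) → covers rest e (i , Pe) }
    ; confined = confined′ }
    where
    first = attach zero S q λ v sv occ → let Bv , away = inv zero v sv occ in trans (qB v) Bv , away
    rest = attach-all (Ps ∘ suc) B (attach ∘ suc) (λ i j v i≢j → meet (suc i) (suc j) v (i≢j ∘ suc-injective))
      (result first) (embed (extends first) q) (λ v → trans (bag-embed (extends first) q v) (qB v)) inv′
      where
      inv′ : ∀ i v → support (Ps (suc i)) v ≡ true → Occurs (result first) v →
             B v ≡ true × support (not ∘ Ps (suc i)) v ≡ true
      inv′ i v sv occ with confined first v occ
      ... | inj₁ occ₀ = inv (suc i) v sv occ₀
      ... | inj₂ s₀v  = meet (suc i) zero v (λ ()) sv s₀v
    confined′ : ∀ v → Occurs (result rest) v → Occurs S v ⊎ ∃ λ i → support (Ps i) v ≡ true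
    confined′ v occ with confined rest v occ
    ... | inj₂ (i , sv) = inj₂ (suc i , sv)
    ... | inj₁ occ₁ with confined first v occ₁
    ... | inj₁ occ₀ = inj₁ occ₀
    ... | inj₂ s₀v  = inj₂ (zero , s₀v)

  module _ {Q} (s : Split Q) (attach : ∀ i → Attachable (Split.part s i)) where

    open Split s renaming (bag to splitBag; small to splitBag-small)

    private
      Meets : Fin n → Set
      Meets v = ∃₂ λ e e′ → inc e v ≡ true × inc e′ v ≡ true × colour e ≢ colour e′

      meets? : ∀ v → Dec (Meets v)
      meets? v = any? λ e → any? λ e′ →
        (inc e v ≟ true) ×-dec (inc e′ v ≟ true) ×-dec ¬? (colour e Fin.≟ colour e′)

      -- The bag of a split may contain unnecessary vertices; trimming it to the vertices where two
      -- colours meet makes the bags coherent.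
      B : Fin n → Bool
      B v = does (meets? v)

      B-small : count B ≤ suc k
      B-small = ℕ.≤-trans (count-mono B splitBag λ v Bv →
        let e , e′ , ev , e′v , c≢c′ = does-true (meets? v) Bv
        in decidable-stable (splitBag v ≟ true) λ ∉bag → c≢c′ (border v e e′ ev e′v (¬-not ∉bag))) splitBag-small

      in-Q : ∀ {e i} → colour e ≡ suc i → Q e ≡ true
      in-Q {e} eq = trans (outside e) (cong (λ c → not (c == zero)) eq)

      part-of : ∀ {e} → Q e ≡ true → ∃ λ i → part i e ≡ true
      part-of {e} Qe with colour e | outside e
      ... | zero  | out = contradiction Qe (λ Qe → clash Qe out)
      ... | suc i | out = i , ==-refl (suc i)

      colour-support : ∀ {e v} → inc e v ≡ true → ∀ {i} → colour e ≡ suc i → support Q v ≡ true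
      colour-support ev eq = support⁺ Q ev (in-Q eq)

      B-support : ∀ v → B v ≡ true → support Q v ≡ true
      B-support v Bv with does-true (meets? v) Bv
      ... | e , e′ , ev , e′v , c≢c′ with colour e in ce | colour e′ in ce′
      ... | suc _ | _     = colour-support ev ce
      ... | zero  | suc _ = colour-support e′v ce′
      ... | zero  | zero  = contradiction refl c≢c′

      part-colour : ∀ i {e} → part i e ≡ true → colour e ≡ suc i
      part-colour i {e} = ==-true (colour e) (suc i)

      meet-outside : ∀ i {v e e′} → inc e v ≡ true → part i e ≡ true → inc e′ v ≡ true → colour e′ ≢ suc i →
                     B v ≡ true × support (not ∘ part i) v ≡ true
      meet-outside i {v} {e} {e′} ev ei e′v e′≢i =
          dec-true (meets? v) (e , e′ , ev , e′v , λ eq → e′≢i (trans (sym eq) (part-colour i ei)))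
        , support⁺ (not ∘ part i) e′v (cong not (==-false (colour e′) (suc i) e′≢i))

      parts-meet : ∀ i j v → i ≢ j → support (part i) v ≡ true → support (part j) v ≡ true →
                   B v ≡ true × support (not ∘ part i) v ≡ true
      parts-meet i j v i≢j siv sjv =
        let e , ev , ei = support⁻ (part i) siv
            e′ , e′v , e′j = support⁻ (part j) sjv
        in meet-outside i ev ei e′v λ eq → i≢j (suc-injective (trans (sym eq) (part-colour j e′j)))

    attach-split : Attachable Q
    attach-split S p inv = record
      { result   = result all
      ; extends  = extends-trans graft-extends (extends all)
      ; covers   = λ e Qe → covers all e (part-of Qe)
      ; confined = confined′ }
      where
      S₁ = graft S p B B-small λ v Bv occ → proj₁ (inv v (B-support v Bv) occ)

      part-support : ∀ i v → support (part i) v ≡ true → support Q v ≡ true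
      part-support i v sv = let e , ev , ei = support⁻ (part i) sv in colour-support ev (part-colour i ei)

      -- A vertex of part `i` already present meets a second colour: by trimming if it is in `B`,
      -- and through an edge outside `Q` if it occurs in `S`.
      inv₁ : ∀ i v → support (part i) v ≡ true → Occurs S₁ v → B v ≡ true × support (not ∘ part i) v ≡ true
      inv₁ i v sv (zero , Bv) with does-true (meets? v) Bv
      ... | e , e′ , ev , e′v , c≢c′ with colour e Fin.≟ suc i
      ... | yes ei = meet-outside i ev (dec-true (_ Fin.≟ _) ei) e′v λ e′i → c≢c′ (trans ei (sym e′i))
      ... | no e≢i = let e₀ , e₀v , e₀i = support⁻ (part i) sv in meet-outside i e₀v e₀i ev e≢i
      inv₁ i v sv (suc t , bv) =
        let e₀ , e₀v , e₀i = support⁻ (part i) sv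
            e′ , e′v , out = support⁻ (not ∘ Q) (proj₂ (inv v (part-support i v sv) (t , bv)))
        in meet-outside i e₀v e₀i e′v λ eq → clash out (cong not (in-Q eq))

      all = attach-all part B attach parts-meet S₁ zero (λ _ → refl) inv₁

      confined′ : ∀ v → Occurs (result all) v → Occurs S v ⊎ support Q v ≡ true
      confined′ v occ with confined all v occ
      ... | inj₂ (i , sv)       = inj₂ (part-support i v sv)
      ... | inj₁ (zero , Bv)    = inj₂ (B-support v Bv)
      ... | inj₁ (suc t , bv)   = inj₁ (t , bv)

  attachable : ∀ {Q} → Decomposes FitsInBag Q → Attachable Q
  attachable (node s d) = attach-split s λ i → attachable (d i)
  attachable {Q} (leaf fits) S p inv = record
    { result   = graft S p (support Q) fits λ v sv occ → proj₁ (inv v sv occ)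
    ; extends  = graft-extends
    ; covers   = λ e Qe → zero , λ v ev → support⁺ Q ev Qe
    ; confined = λ { v (zero , sv) → inj₂ sv ; v (suc t , bv) → inj₁ (t , bv) } }

  bag-tree : Decomposes FitsInBag full → ∃ λ S → ∀ e → Covers S e
  bag-tree d = result attached , λ e → covers attached e refl
    where
    -- A single node with empty bag: no vertex occurs, so the condition for attaching is void.
    start : BagTree
    start = record
      { tree = singleton ; isTree = singleton-isTree ; bag = λ _ _ → false
      ; small = λ _ → ℕ.≤-trans (ℕ.≤-reflexive (sum-zero n)) z≤n
      ; coherent = λ _ _ _ () }
    attached = attachable d start zero λ { _ _ (_ , ()) }

-- Havens from large tree-width

-- first p is suc of the least x with p x, and zero if there is none.
first : ∀ {n} → (Fin n → Bool) → Fin (suc n)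
first {zero}  p = zero
first {suc n} p = if p zero then suc zero else Fin.lift 1 suc (first (p ∘ suc))

first-cong : ∀ {n} {p q : Fin n → Bool} → p ≗ q → first p ≡ first q
first-cong {zero}  p≗q = refl
first-cong {suc n} p≗q = cong₂ (λ b i → if b then suc zero else Fin.lift 1 suc i)
  (p≗q zero) (first-cong (p≗q ∘ suc))

first-none : ∀ {n} (p : Fin n → Bool) → first p ≡ zero → ∀ x → p x ≡ false
first-none {suc n} p eq x with p zero in p0 | first (p ∘ suc) in f
first-none {suc n} p eq zero    | false | zero = p0
first-none {suc n} p eq (suc x) | false | zero = first-none (p ∘ suc) f x

first-some : ∀ {n} (p : Fin n → Bool) {x} → first p ≡ suc x → p x ≡ true
first-some {suc n} p eq with p zero in p0 | first (p ∘ suc) in f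
first-some {suc n} p refl | true  | _     = p0
first-some {suc n} p refl | false | suc x = first-some (p ∘ suc) f

module _ (F : Graph) (k : ℕ) where

  open Links F

  private
    n = size F

  InEdge : Fin (n * n) → Fin n → Set
  InEdge e v = let (i , j) = remQuot {n} n e in (i ≡ j ⊎ Adj F i j) × (v ≡ i ⊎ v ≡ j)

  inEdge? : ∀ e v → Dec (InEdge e v)
  inEdge? e v = let (i , j) = remQuot {n} n e in
    ((i Fin.≟ j) ⊎-dec (adj F i j ≟ true)) ×-dec ((v Fin.≟ i) ⊎-dec (v Fin.≟ j))

  -- The hyperedges are the edges of F, together with a loop at each vertex so that isolated
  -- vertices are covered too; pairs (i , j) that are neither have no vertices.
  incident : Fin (n * n) → Fin n → Bool
  incident e v = does (inEdge? e v)

  open Duality k incident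
  open Assembly k incident

  incident-combine : ∀ i j → i ≡ j ⊎ Adj F i j → ∀ v → v ≡ i ⊎ v ≡ j → incident (combine i j) v ≡ true
  incident-combine i j ij v vij = dec-true (inEdge? (combine i j) v)
    (subst (λ (i , j) → (i ≡ j ⊎ Adj F i j) × (v ≡ i ⊎ v ≡ j)) (sym (remQuot-combine i j)) (ij , vij))

  same-edge : ∀ e v w → incident e v ≡ true → incident e w ≡ true → v ≡ w ⊎ Adj F v w
  same-edge e v w ev ew with does-true (inEdge? e v) ev | does-true (inEdge? e w) ew
  ... | _ , inj₁ refl | _ , inj₁ refl = inj₁ refl
  ... | _ , inj₂ refl | _ , inj₂ refl = inj₁ refl
  ... | inj₁ eq , inj₁ refl | _ , inj₂ refl = inj₁ eq
  ... | inj₂ a  , inj₁ refl | _ , inj₂ refl = inj₂ a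
  ... | inj₁ eq , inj₂ refl | _ , inj₁ refl = inj₁ (sym eq)
  ... | inj₂ a  , inj₂ refl | _ , inj₁ refl = inj₂ (trans (adj-sym F _ _) a)

  tree-decomposition : Decomposes FitsInBag full → TwAtMost k F
  tree-decomposition d = record
    { tree      = tree
    ; isTree    = isTree
    ; bag       = tabulate ∘ bag
    ; vertexCov = λ v → let t , cov = covers (combine v v) in
        t , to (cov v (incident-combine v v (inj₁ refl) v (inj₁ refl)))
    ; edgeCov   = λ v w vw → let t , cov = covers (combine v w) in
        t , to (cov v (incident-combine v w (inj₂ vw) v (inj₁ refl)))
          , to (cov w (incident-combine v w (inj₂ vw) w (inj₂ refl)))
    ; connected = λ v s t v∈s v∈t → Walks.map-walk tree to (coherent v s t (from v∈s) (from v∈t))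
    } , λ t → ℕ.≤-trans (ℕ.≤-reflexive (trans (sym (count-lookup (tabulate (bag t))))
                                              (count-cong (lookup∘tabulate (bag t)))))
                        (small t)
    where
    open BagTree (proj₁ (bag-tree d))
    covers = proj₂ (bag-tree d)
    to : ∀ {t v} → bag t v ≡ true → v ∈ tabulate (bag t)
    to {t} {v} b = lookup⇒[]= v _ (trans (lookup∘tabulate (bag t) v) b)
    from : ∀ {t v} → v ∈ tabulate (bag t) → bag t v ≡ true
    from {t} {v} v∈ = trans (sym (lookup∘tabulate (bag t) v)) ([]=⇒lookup v∈)

  Touches : (Fin n → Bool) → Fin n → Fin (n * n) → Set
  Touches X r e = ∃ λ v → incident e v ≡ true × X v ≡ false × Linked X r v

  touches? : ∀ X r e → Dec (Touches X r e)
  touches? X r e = any? λ v → (incident e v ≟ true) ×-dec (X v ≟ false) ×-dec linked? X r v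

  -- The edges meeting the component of r in F − X, by the reading of Linked as reachability.
  component : (Fin n → Bool) → Fin n → EdgeSet
  component X r e = does (touches? X r e)

  -- All vertices of `e` outside `X` lie in one component of `F − X`, so any of them decides.
  component-at : ∀ X r e v → incident e v ≡ true → X v ≡ false → component X r e ≡ does (linked? X r v)
  component-at X r e v ev Xv = does-⇔ (mk⇔ fwd λ l → v , ev , Xv , l) (touches? X r e) (linked? X r v)
    where
    fwd : Touches X r e → Linked X r v
    fwd (w , ew , Xw , l) with same-edge e w v ew ev
    ... | inj₁ refl = l
    ... | inj₂ wv   = linked-trans l (linked-adj wv Xw Xv)

  -- The vertex of `e` outside `X` and the one outside `Y` are both outside `X ∩ Y`, so they are
  -- equal or linked by their edge.
  touching-linked : ∀ {X Y r s} e → Touches X r e → Touches Y s e → Linked (X ∩ Y) r s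
  touching-linked {X} {Y} e (v , ev , Xv , rv) (w , ew , Yw , sw) =
    linked-trans (linked-mono (λ z → ∧-left (X z)) rv)
      (linked-trans (v-w (same-edge e v w ev ew)) (linked-sym (linked-mono (λ z → ∧-right (X z)) sw)))
    where
    ∧-left : ∀ a {b} → a ∧ b ≡ true → a ≡ true
    ∧-left true _ = refl
    ∧-right : ∀ a {b} → a ∧ b ≡ true → b ≡ true
    ∧-right true eq = eq
    v-w : v ≡ w ⊎ Adj F v w → Linked (X ∩ Y) v w
    v-w (inj₁ refl) = linked-refl _ v
    v-w (inj₂ vw)   = linked-adj vw (cong (_∧ Y v) Xv) (trans (cong (X w ∧_) Yw) (∧-zeroʳ (X w)))

  module _ {M : Subset (2 ^ (n * n))} (con : Consistent M) (sat : Saturated M) where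

    open Consistent con

    Candidate : (Fin n → Bool) → Fin n → Set
    Candidate X r = X r ≡ false × Large M (component X r)

    candidate? : ∀ X r → Dec (Candidate X r)
    candidate? X r = (X r ≟ false) ×-dec (encode (component X r) ∈? M)

    -- Otherwise `X` is the bag of a split of `full` all of whose parts are small: one for each
    -- component of `F − X`, and one with support inside `X`.
    candidate-exists : ∀ X → count X ≤ suc k → ∃ (Candidate X)
    candidate-exists X X-small = decidable-stable (any? (candidate? X)) λ none →
      indecomposed (node split λ
        { zero    → leaf (fits (Split.part split zero) (ℕ.≤-trans
            (count-mono (support (Split.part split zero)) X uncoloured) X-small))
        ; (suc r) → leaf (λ large → none (r , large-part r large)) })
      where
      candidates : Fin (n * n) → Fin n → Bool
      candidates e r = not (X r) ∧ component X r e

      split : Split full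
      split = record
        -- An edge is coloured by the least vertex of the component it meets, and by `suc zero` if
        -- all its vertices are in `X`; the outer `suc` leaves `zero` to the empty complement of
        -- `full`.
        { colour  = λ e → suc (first (candidates e))
        ; bag     = X
        ; small   = X-small
        ; outside = λ _ → refl
        ; border  = λ v e e′ ev e′v Xv → cong suc (first-cong λ r → cong (not (X r) ∧_)
            (trans (component-at X r e v ev Xv) (sym (component-at X r e′ v e′v Xv))))
        }

      uncoloured : ∀ v → support (Split.part split zero) v ≡ true → X v ≡ true
      uncoloured v sv with X v in Xv
      ... | true  = refl
      ... | false with e , ev , ez ← support⁻ (Split.part split zero) {v} sv =
        contradiction
          (trans (sym (cong₂ (λ b c → not b ∧ c) Xv (dec-true (touches? X v e) (v , ev , Xv , linked-refl X v))))
                 (first-none (candidates e) (==-true (first (candidates e)) zero ez) v))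
          λ ()

      ∧-true : ∀ {a b} → not a ∧ b ≡ true → a ≡ false × b ≡ true
      ∧-true {false} {true} _ = refl , refl

      part-candidate : ∀ r e → Split.part split (suc r) e ≡ true → X r ≡ false × component X r e ≡ true
      part-candidate r e er =
        ∧-true (first-some (candidates e) (==-true (first (candidates e)) (suc r) er))

      large-part : ∀ r → Large M (Split.part split (suc r)) → Candidate X r
      large-part r large = proj₁ (part-candidate r (proj₁ nonempty) (proj₂ nonempty))
        , decidable-stable (_ ∈? M) λ small-component →
            down (Split.part split (suc r)) (component X r) (λ e → proj₂ ∘ part-candidate r e) small-component large
        where nonempty = large-nonempty con large

    candidates-linked : ∀ {X Y r s} → Candidate X r → Candidate Y s → Linked (X ∩ Y) r s
    candidates-linked {X} {Y} {r} {s} (_ , largeX) (_ , largeY) =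
      let e , eX , eY = large-sets-meet con sat (component X r) (component Y s) largeX largeY
      in touching-linked e (does-true (touches? X r e) eX) (does-true (touches? Y s e) eY)

    saturated-haven : Haven k
    saturated-haven = record
      { at     = at
      ; avoids = λ X sX → proj₁ (at-candidate X sX)
      ; joined = λ X Y sX sY → candidates-linked (at-candidate X sX) (at-candidate Y sY)
      }
      where
      -- The value at sets without a candidate, which have more than `suc k` elements; it is taken
      -- from the empty set.
      default : Fin n
      default = proj₁ (candidate-exists (λ _ → false) (ℕ.≤-trans (ℕ.≤-reflexive (sum-zero n)) z≤n))

      at : (Fin n → Bool) → Fin n
      at X with any? (candidate? X)
      ... | yes (r , _) = r
      ... | no _        = default

      at-candidate : ∀ X → count X ≤ suc k → Candidate X (at X)
      at-candidate X sX with any? (candidate? X)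
      ... | yes (_ , c) = c
      ... | no none     = contradiction (candidate-exists X sX) none

  -- The saturated family is obtained only under a double negation, which `haven-stable` removes.
  haven : ¬ TwAtMost k F → Haven k
  haven ¬tw = haven-stable λ ¬haven →
    let M , con = initial (¬tw ∘ tree-decomposition)
    in saturate M (⊂-wellFounded M) con λ (_ , con , sat) → ¬haven (saturated-haven con sat)

theorem1p2 : ∀ (k : ℕ) → 1 ≤ k → ∀ (F : Graph) → ¬ TwAtMost k F →
    Σ Graph λ G → Σ Graph λ H →
    (∀ (F′ : Graph) → TwAtMost k F′ → hom F′ G ≡ hom F′ H) × (hom F G ≢ hom F H)
theorem1p2 k _ F ¬tw = haven-separates F (haven F k ¬tw)
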